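{- Let $N\in\mathbb{Z}_{\ge2}$ and let $b_1,\dots,b_t$ be any ordering of $\mathscr{B}_N$, with associated sequence $\Delta_1,\dots,\Delta_t$. Then the vectors $$\sum_{j=1}^t c_{b_j}e_{b_j}-\Big(\sum_{j=1}^t c_{b_j}\Big)e_1,\qquad c_{b_j}\in\mathbb{Z},\ 0\le c_{b_j}<\Delta_j,$$ form a complete system of representatives of $S(N)/Z(N)$.
   Context: $\mathscr{D}(N)$ is the set of positive divisors of $N$, $\{e_n\}_{n\mid N}$ the standard basis of $\mathbb{Z}^{\mathscr{D}(N)}$. $S(N)=\{(r_n)_{n\mid N}\in\mathbb{Z}^{\mathscr{D}(N)}:\sum_n r_n=0\}$. $Z(N)$ is the subgroup of $(r_n)\in S(N)$ with $\sum_{n\mid N}nr_n\equiv0\pmod{24}$, $\sum_{n\mid N}\frac Nn r_n\equiv0\pmod{24}$, and $\prod_{n:\,r_n\text{ odd}}n$ a perfect square. For a prime $p\mid N$: $\mathscr{B}_N^p=\{p\}$ if $p\ne2,3$; $\mathscr{B}_N^2=\{2\}$ if $v_2(N)=1$, $\{2,4\}$ if $v_2(N)=2$, $\{2^{\alpha-2},2^{\alpha-1},2^\alpha\}$ if $v_2(N)=\alpha\ge3$; $\mathscr{B}_N^3=\{3\}$ if $v_3(N)=1$, $\{3^{\alpha-1},3^\alpha\}$ if $v_3(N)=\alpha\ge2$; $\mathscr{B}_N=\bigcup_{p\mid N}\mathscr{B}_N^p$. For integers $(c_n)_{n\in\mathscr{B}_N}$ consider the system (S): $\sum_{n\in\mathscr{B}_N}(n-1)c_n\equiv0\pmod{24}$;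 $\sum_{n\in\mathscr{B}_N}(N/n-N)c_n\equiv0\pmod{24}$; $c_p\equiv0\pmod2$ for every prime $p\mid N$, $p\ne2,3$; $\sum_{2^\beta\in\mathscr{B}_N,\,c_{2^\beta}\text{ odd}}\beta\equiv0\pmod2$ and $\sum_{3^\beta\in\mathscr{B}_N,\,c_{3^\beta}\text{ odd}}\beta\equiv0\pmod2$. For an ordering $b_1,\dots,b_t$ of $\mathscr{B}_N$, $\Delta_i$ is the least $m\in\{1,\dots,24\}$ such that some $(c_n)$ satisfies (S) with $c_{b_j}=0$ for $j<i$ and $c_{b_i}=m$. -}

module Defs where

open import Data.Bool.Base using (if_then_else_)
open import Data.Fin.Base as Fin using (Fin)
open import Data.Integer.Base as ℤ using (ℤ; +_; 0ℤ; 1ℤ)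
open import Data.Integer.Divisibility.Signed using (_∣_; _∣?_)
open import Data.Irrelevant using ([_])
open import Data.List.Base using (List; []; _∷_; allFin; concatMap; filter; foldr; map; mapMaybe; upTo)
open import Data.List.Membership.DecPropositional using () renaming (_∈?_ to member?)
open import Data.List.Membership.Propositional using (_∈_)
open import Data.List.Relation.Unary.All as All using (All; []; _∷_)
open import Data.List.Relation.Unary.All.Properties using (all-filter; concat⁺; map⁺)
open import Data.Maybe.Base using (Maybe; just; nothing)
open import Data.Nat.Base as ℕ using (ℕ; zero; suc; NonZero; _^_; _≤_; z≤n; s≤s)
open import Data.Nat.Divisibility as ℕᵈ using (1∣_; ∣-trans)
open import Data.Nat.ListAction using (product; sum)
open import Data.Nat.DivMod using (_/_)
open import Data.Nat.Primality using (Prime; prime?; prime⇒nonZero)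
open import Data.Nat.Properties as ℕᵖ using (m^n≢0)
open import Data.Product.Base using (_×_; _,_; ∃; proj₁)
open import Data.Product using (∃!)
open import Data.Refinement.Base using (Refinement; _,_; value; refine)
open import Function.Bundles using (_⤖_; Bijection)
open import Level using (0ℓ)
open import Relation.Binary.PropositionalEquality using (_≡_; _≢_; _≗_)
open import Relation.Nullary using (¬_; yes; no; does; ¬?; _×-dec_)
open import Relation.Unary using (Pred; Decidable; _⊆_)

∑ : {A : Set} → List A → (A → ℤ) → ℤ
∑ xs f = foldr (λ x s → f x ℤ.+ s) 0ℤ xs

-- A subset of ℕ is the refinement type of its predicate: membership proofs are
-- irrelevant, so elements are equal as soon as their values are.
select : {P : Pred ℕ 0ℓ} → Decidable P → ℕ → Maybe (Refinement ℕ P)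
select P? n with P? n
... | yes p = just (n , [ p ])
... | no  _ = nothing

-- The elements that are ≤ M, without repetition.
elements : {P : Pred ℕ 0ℓ} → Decidable P → ℕ → List (Refinement ℕ P)
elements P? M = mapMaybe (select P?) (upTo (suc M))

Odd : Pred ℤ 0ℓ
Odd z = ¬ (+ 2 ∣ z)

odd? : Decidable Odd
odd? z = ¬? (+ 2 ∣? z)

PerfectSquare : Pred ℕ 0ℓ
PerfectSquare n = ∃ λ k → n ≡ k ℕ.* k

PosDivisor : ℕ → Pred ℕ 0ℓ
PosDivisor N n = NonZero n × n ℕᵈ.∣ N

𝓓 : ℕ → Set
𝓓 N = Refinement ℕ (PosDivisor N)

divisors : (N : ℕ) → List (𝓓 N)
divisors N = elements (λ n → ℕᵖ.nonZero? n ×-dec n ℕᵈ.∣? N) N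

one : ∀ {N} → 𝓓 N
one {N} = 1 , [ (_ , 1∣ N) ]

codivisor : ∀ {N} → 𝓓 N → ℕ
codivisor {N} (n , [ d ]) = _/_ N n {{proj₁ d}}

Lattice : ℕ → Set
Lattice N = 𝓓 N → ℤ

infixl 6 _⊖_
_⊖_ : ∀ {N} → Lattice N → Lattice N → Lattice N
(r ⊖ s) n = r n ℤ.- s n

e : ∀ {N} → 𝓓 N → Lattice N
e n m = if does (value n ℕᵖ.≟ value m) then 1ℤ else 0ℤ

S : (N : ℕ) → Pred (Lattice N) 0ℓ
S N r = ∑ (divisors N) r ≡ 0ℤ

record Z (N : ℕ) (r : Lattice N) : Set where
  field
    degree   : S N r
    order-∞  : + 24 ∣ ∑ (divisors N) (λ n → + value n ℤ.* r n)
    order-0  : + 24 ∣ ∑ (divisors N) (λ n → + codivisor n ℤ.* r n)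
    square   : PerfectSquare (product (map value (filter (λ n → odd? (r n)) (divisors N))))

largest : {P : Pred ℕ 0ℓ} → Decidable P → ℕ → ℕ
largest P? zero    = zero
largest P? (suc k) = if does (P? (suc k)) then suc k else largest P? k

-- The p-adic valuation of N, for p ≥ 2 and N ≥ 1: p ^ k ∣ N forces k < N.
v : ℕ → ℕ → ℕ
v p N = largest (λ k → p ^ k ℕᵈ.∣? N) N

primeDivisors : ℕ → List ℕ
primeDivisors N = filter (λ p → prime? p ×-dec p ℕᵈ.∣? N) (upTo (suc N))

-- The argument of 𝓑² and 𝓑³ is the valuation of N, positive whenever used.
𝓑² : ℕ → List ℕ
𝓑² 0 = []
𝓑² 1 = 2 ∷ []
𝓑² 2 = 2 ∷ 4 ∷ []
𝓑² α@(suc (suc (suc _))) = 2 ^ (α ℕ.∸ 2) ∷ 2 ^ (α ℕ.∸ 1) ∷ 2 ^ α ∷ []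

𝓑³ : ℕ → List ℕ
𝓑³ 0 = []
𝓑³ 1 = 3 ∷ []
𝓑³ α@(suc (suc _)) = 3 ^ (α ℕ.∸ 1) ∷ 3 ^ α ∷ []

𝓑ᵖ : ℕ → ℕ → List ℕ
𝓑ᵖ N 2 = 𝓑² (v 2 N)
𝓑ᵖ N 3 = 𝓑³ (v 3 N)
𝓑ᵖ N p = p ∷ []

𝓑-list : ℕ → List ℕ
𝓑-list N = concatMap (𝓑ᵖ N) (primeDivisors N)

𝓑 : ℕ → Set
𝓑 N = Refinement ℕ (_∈ 𝓑-list N)

𝓑-elements : (N : ℕ) → List (𝓑 N)
𝓑-elements N = elements (λ n → member? ℕᵖ._≟_ n (𝓑-list N)) N

^-v-∣ : ∀ p N → p ^ v p N ℕᵈ.∣ N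
^-v-∣ p N = go N
  where
  go : ∀ k → p ^ largest (λ k → p ^ k ℕᵈ.∣? N) k ℕᵈ.∣ N
  go zero = 1∣ N
  go (suc k) with p ^ suc k ℕᵈ.∣? N
  ... | yes d = d
  ... | no  _ = go k

^-∣-^ : ∀ p {m n} → m ≤ n → p ^ m ℕᵈ.∣ p ^ n
^-∣-^ p {n = n} z≤n = 1∣ (p ^ n)
^-∣-^ p (s≤s m≤n) = ℕᵈ.*-monoʳ-∣ p (^-∣-^ p m≤n)

power : ∀ p .{{_ : NonZero p}} {N m α} → p ^ α ℕᵈ.∣ N → m ≤ α → PosDivisor N (p ^ m)
power p {m = m} d m≤α = m^n≢0 p m , ∣-trans (^-∣-^ p m≤α) d

𝓑²-divides : ∀ {N} α → 2 ^ α ℕᵈ.∣ N → All (PosDivisor N) (𝓑² α)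
𝓑²-divides 0 d = []
𝓑²-divides 1 d = power 2 {m = 1} {1} d ℕᵖ.≤-refl ∷ []
𝓑²-divides 2 d = power 2 {m = 1} {2} d (s≤s z≤n) ∷ power 2 {m = 2} {2} d ℕᵖ.≤-refl ∷ []
𝓑²-divides α@(suc (suc (suc _))) d =
  power 2 {m = α ℕ.∸ 2} {α} d (ℕᵖ.m∸n≤m α 2) ∷ power 2 {m = α ℕ.∸ 1} {α} d (ℕᵖ.m∸n≤m α 1) ∷ power 2 {m = α} {α} d ℕᵖ.≤-refl ∷ []

𝓑³-divides : ∀ {N} α → 3 ^ α ℕᵈ.∣ N → All (PosDivisor N) (𝓑³ α)
𝓑³-divides 0 d = []
𝓑³-divides 1 d = power 3 {m = 1} {1} d ℕᵖ.≤-refl ∷ []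
𝓑³-divides α@(suc (suc _)) d =
  power 3 {m = α ℕ.∸ 1} {α} d (ℕᵖ.m∸n≤m α 1) ∷ power 3 {m = α} {α} d ℕᵖ.≤-refl ∷ []

𝓑ᵖ-divides : ∀ N {p} → Prime p × p ℕᵈ.∣ N → All (PosDivisor N) (𝓑ᵖ N p)
𝓑ᵖ-divides N {0} (pp , d) = (prime⇒nonZero pp , d) ∷ []
𝓑ᵖ-divides N {1} (pp , d) = (prime⇒nonZero pp , d) ∷ []
𝓑ᵖ-divides N {2} _ = 𝓑²-divides (v 2 N) (^-v-∣ 2 N)
𝓑ᵖ-divides N {3} _ = 𝓑³-divides (v 3 N) (^-v-∣ 3 N)
𝓑ᵖ-divides N {suc (suc (suc (suc _)))} (pp , d) = (prime⇒nonZero pp , d) ∷ []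

𝓑-divides : ∀ N {n} → n ∈ 𝓑-list N → PosDivisor N n
𝓑-divides N = All.lookup (concat⁺ (map⁺ (All.map (𝓑ᵖ-divides N)
  (all-filter (λ p → prime? p ×-dec p ℕᵈ.∣? N) (upTo (suc N))))))

𝓑⇒𝓓 : ∀ N → 𝓑 N → 𝓓 N
𝓑⇒𝓓 N = refine (𝓑-divides N)

-- The exponents β with p ^ β ∈ 𝓑_N; since p ^ β ∣ N, they are bounded by N.
exponents : (p N : ℕ) → List (Refinement ℕ (λ β → p ^ β ∈ 𝓑-list N))
exponents p N = elements (λ β → member? ℕᵖ._≟_ (p ^ β) (𝓑-list N)) N

at-power : ∀ p N → (𝓑 N → ℤ) → Refinement ℕ (λ β → p ^ β ∈ 𝓑-list N) → ℤ
at-power p N c (β , q) = c (p ^ β , q)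

oddExponentSum : (p N : ℕ) → (𝓑 N → ℤ) → ℕ
oddExponentSum p N c = sum (map value (filter (λ β → odd? (at-power p N c β)) (exponents p N)))

record System (N : ℕ) (c : 𝓑 N → ℤ) : Set where
  field
    order-∞ : + 24 ∣ ∑ (𝓑-elements N) (λ n → (+ value n ℤ.- 1ℤ) ℤ.* c n)
    order-0 : + 24 ∣ ∑ (𝓑-elements N) (λ n → (+ codivisor (𝓑⇒𝓓 N n) ℤ.- + N) ℤ.* c n)
    even    : ∀ p → Prime p → p ℕᵈ.∣ N → p ≢ 2 → p ≢ 3 →
              (p∈𝓑 : p ∈ 𝓑-list N) → + 2 ∣ c (p , [ p∈𝓑 ])
    parity₂ : 2 ℕᵈ.∣ oddExponentSum 2 N c
    parity₃ : 2 ℕᵈ.∣ oddExponentSum 3 N c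

Ordering : ℕ → ℕ → Set
Ordering N t = Fin t ⤖ 𝓑 N

module _ (N : ℕ) {t : ℕ} (b : Ordering N t) where
  open Bijection b using (to)

  Attained : Fin t → Pred ℕ 0ℓ
  Attained i m = ∃ λ (c : 𝓑 N → ℤ) →
    System N c × (∀ j → j Fin.< i → c (to j) ≡ 0ℤ) × c (to i) ≡ + m

  record IsΔ (i : Fin t) (m : ℕ) : Set where
    field
      1≤m      : 1 ≤ m
      m≤24     : m ≤ 24
      attained : Attained i m
      least    : ∀ {m′} → 1 ≤ m′ → m′ ≤ 24 → Attained i m′ → m ≤ m′

  vector : (𝓑 N → ℤ) → Lattice N
  vector c n = ∑ (allFin t) (λ j → c (to j) ℤ.* e (𝓑⇒𝓓 N (to j)) n)
               ℤ.- ∑ (allFin t) (λ j → c (to j)) ℤ.* e one n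

  Representative : (Fin t → ℕ) → Pred (Lattice N) 0ℓ
  Representative Δ r = ∃ λ (c : 𝓑 N → ℤ) →
    (∀ j → 0ℤ ℤ.≤ c (to j) × c (to j) ℤ.< + Δ j) × r ≗ vector c

-- R ⊆ G meets every coset of H in G exactly once.
CompleteRepresentatives : ∀ {N} (G H R : Pred (Lattice N) 0ℓ) → Set
CompleteRepresentatives G H R =
  R ⊆ G × (∀ r → G r → ∃! _≗_ (λ s → R s × H (r ⊖ s)))

{-# OPTIONS --safe #-}
module Submission where

-- S(N)/Z(N) is detected by the linear functionals Σ n r_n and Σ (N/n) r_n modulo 24 and, for each
-- prime p, Σ v_p(n) r_n modulo 2.  On the vectors supported on 𝓑_N ∪ {1} the kernel of these
-- functionals is the solution lattice of (S), so that division with remainder by Δ_1, Δ_2, … in the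
-- triangular system of solutions reduces every coefficient vector to exactly one in the box.
--
-- It remains to see that the e_b − e_1, b ∈ 𝓑_N, generate S(N)/Z(N).  Modulo 3 and modulo (8, parity)
-- separately, e_{nm} − e_1 ≡ m (e_n − e_1) + (e_m − e_1) whenever m is prime to 3, respectively 2,
-- because m² ≡ 1; this reduces to the powers of 3, respectively 2, which are treated by hand.

open import Defs
open import Data.Bool.Base using (if_then_else_)
open import Data.Fin.Base as Fin using (Fin; toℕ)
import Data.Fin.Properties as Finᵖ
open import Data.Integer.Base as ℤ using (ℤ; +_; 0ℤ; 1ℤ; _+_; _*_; _-_; -_)
open import Data.Integer.DivMod using (a≡a%ℕn+[a/ℕn]*n; n%ℕd<d)
open import Data.Integer.Divisibility.Signed as ℤᵈ using (_∣_; divides)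
import Data.Integer.Properties as ℤᵖ
open import Data.Integer.Tactic.RingSolver using (solve-∀)
open import Data.Irrelevant using ([_])
open import Data.List.Base using (List; []; _∷_; allFin; filter; map; mapMaybe; upTo)
open import Data.List.Membership.DecPropositional using () renaming (_∈?_ to member?)
open import Data.List.Membership.Propositional using (_∈_)
open import Data.List.Membership.Propositional.Properties using (∈-allFin; ∈-concatMap⁺; ∈-filter⁺; ∈-upTo⁺)
open import Data.List.Properties using (filter-accept; filter-reject; map-∘)
open import Data.List.Relation.Unary.All as All using (All; []; _∷_)
open import Data.List.Relation.Unary.All.Properties using (all-filter; concat⁺; map⁺)
open import Data.List.Relation.Unary.AllPairs using ([]; _∷_)
open import Data.List.Relation.Unary.Any as Any using (here; there)
open import Data.List.Relation.Unary.Unique.Propositional using (Unique)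
open import Data.List.Relation.Unary.Unique.Propositional.Properties using (allFin⁺; upTo⁺)
open import Data.Nat.Base as ℕ using (ℕ; zero; suc; _≤_; s≤s; z≤n; _^_; NonZero; NonTrivial)
open import Data.Nat.DivMod using (m*n/n≡m; n/1≡n)
open import Data.Nat.Divisibility as ℕᵈ using (divides; ∣-trans)
open import Data.Nat.Induction using (<-rec)
open import Data.Nat.ListAction using (product; sum)
open import Data.Nat.Primality
  using (Prime; euclidsLemma; prime?; prime[2]; prime⇒irreducible; prime⇒nonTrivial; prime⇒nonZero; ¬prime[1])
open import Data.Nat.Primality.Factorisation using (factorise)
import Data.Nat.Properties as ℕᵖ
open import Data.Nat.Tactic.RingSolver using () renaming (solve-∀ to solveℕ-∀)
open import Data.Product.Base using (_×_; _,_; ∃; ∃₂; proj₁; proj₂)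
open import Data.Refinement.Base using (Refinement; _,_; value)
open import Data.Sum.Base using (_⊎_; inj₁; inj₂)
open import Function.Base using (_∘_)
open import Function.Bundles using (Bijection)
open import Level using (0ℓ)
open import Relation.Binary.Definitions using (DecidableEquality; tri<; tri≈; tri>)
open import Relation.Binary.PropositionalEquality
open import Relation.Nullary using (¬_; yes; no; contradiction; does; recompute; _×-dec_)
open import Relation.Nullary.Decidable using (dec-false; dec-true; toWitness)
open import Relation.Unary using (Decidable; Pred)

-- Finite sums

-- The square condition is not linear as stated. It becomes linear through v_p: the valuation of the
-- product over the odd r_n is the sum of v_p(n) over those n, which is congruent to Σ v_p(n) r_n
-- modulo 2. The obstacle to generation is that the multiplicative congruence needs m to be a unit,
-- so 2 and 3 both obstruct modulo 24. Splitting 24 = 3 · 8 leaves one bad prime at a time: 2 is a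
-- unit modulo 3, and 3 is a unit modulo 8. The parities, being 2-torsion, travel with the factor 8
-- only. The shape of 𝓑_N at 2 and 3 answers to the powers of the bad prime. Modulo 3 every 3^b with
-- 0 < b < α behaves alike, so 3^(α-1) and 3^α suffice. Modulo 8 the vectors of 2^b with 0 < b < α -
-- 2 vanish at the cusp 0, but the parity of b still has to be matched; combining 2^α with 2^(α-1)
-- or with 2^(α-2) provides the two parities.

private variable
  A B : Set

∑-cong : ∀ (xs : List A) {f g : A → ℤ} → (∀ x → f x ≡ g x) → ∑ xs f ≡ ∑ xs g
∑-cong []       eq = refl
∑-cong (x ∷ xs) eq = cong₂ _+_ (eq x) (∑-cong xs eq)

∑-zero : ∀ (xs : List A) → ∑ xs (λ _ → 0ℤ) ≡ 0ℤ
∑-zero []       = refl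
∑-zero (x ∷ xs) = trans (ℤᵖ.+-identityˡ _) (∑-zero xs)

∑-+ : ∀ (xs : List A) f g → ∑ xs (λ x → f x + g x) ≡ ∑ xs f + ∑ xs g
∑-+ []       f g = refl
∑-+ (x ∷ xs) f g =
  trans (cong (_+_ (f x + g x)) (∑-+ xs f g)) (interchange (f x) (g x) (∑ xs f) (∑ xs g))
  where
  interchange : ∀ a b c d → a + b + (c + d) ≡ a + c + (b + d)
  interchange = solve-∀

∑-*ˡ : ∀ (xs : List A) k f → ∑ xs (λ x → k * f x) ≡ k * ∑ xs f
∑-*ˡ []       k f = sym (ℤᵖ.*-zeroʳ k)
∑-*ˡ (x ∷ xs) k f =
  trans (cong (_+_ (k * f x)) (∑-*ˡ xs k f)) (sym (ℤᵖ.*-distribˡ-+ k (f x) (∑ xs f)))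

∑-swap : ∀ (xs : List A) (ys : List B) (f : A → B → ℤ) →
         ∑ xs (λ x → ∑ ys (f x)) ≡ ∑ ys (λ y → ∑ xs (λ x → f x y))
∑-swap []       ys f = sym (∑-zero ys)
∑-swap (x ∷ xs) ys f =
  trans (cong (_+_ (∑ ys (f x))) (∑-swap xs ys f)) (sym (∑-+ ys (f x) _))

Enumerates : List A → Set
Enumerates xs = Unique xs × (∀ a → a ∈ xs)

∑-vanish : ∀ {xs : List A} {f : A → ℤ} {a} → (∀ x → x ≢ a → f x ≡ 0ℤ) → All (a ≢_) xs → ∑ xs f ≡ 0ℤ
∑-vanish off []           = refl
∑-vanish off (a≢x ∷ a≢xs) = cong₂ _+_ (off _ (≢-sym a≢x)) (∑-vanish off a≢xs)

∑-single : ∀ {xs : List A} → Enumerates xs → ∀ {f : A → ℤ} a →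
           (∀ x → x ≢ a → f x ≡ 0ℤ) → ∑ xs f ≡ f a
∑-single (xs! , all∈) {f} a off = go xs! (all∈ a)
  where
  go : ∀ {xs} → Unique xs → a ∈ xs → ∑ xs f ≡ f a
  go (a≢xs ∷ _) (here refl) =
    trans (cong (_+_ (f a)) (∑-vanish off a≢xs)) (ℤᵖ.+-identityʳ (f a))
  go (x≢xs ∷ xs!) (there a∈xs) =
    trans (cong₂ _+_ (off _ (All.lookup x≢xs a∈xs)) (go xs! a∈xs)) (ℤᵖ.+-identityˡ (f a))

-- Double counting of `h`, which is `g y` on the graph of `f` and 0 elsewhere. A row has the single
-- entry `g (f x)`; a column sums to `g y` because `f` is injective and `g` vanishes off its image.
∑-reindex : DecidableEquality B → ∀ {xs : List A} {ys : List B} → Enumerates xs → Enumerates ys →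
            (f : A → B) → (∀ {x x′} → f x ≡ f x′ → x ≡ x′) →
            (g : B → ℤ) → (∀ y → g y ≡ 0ℤ ⊎ ∃ λ x → f x ≡ y) →
            ∑ ys g ≡ ∑ xs (g ∘ f)
∑-reindex _≟_ {xs} {ys} exs eys f inj g supp = begin
  ∑ ys g                            ≡⟨ ∑-cong ys column ⟨
  ∑ ys (λ y → ∑ xs (λ x → h x y))   ≡⟨ ∑-swap xs ys h ⟨
  ∑ xs (λ x → ∑ ys (h x))           ≡⟨ ∑-cong xs row ⟩
  ∑ xs (g ∘ f)                      ∎
  where
  open ≡-Reasoning
  h : _ → _ → ℤ
  h x y with f x ≟ y
  ... | yes _ = g y
  ... | no  _ = 0ℤ
  h-≡ : ∀ x → h x (f x) ≡ g (f x)
  h-≡ x with f x ≟ f x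
  ... | yes _ = refl
  ... | no neq = contradiction refl neq
  h-≢ : ∀ x y → f x ≢ y → h x y ≡ 0ℤ
  h-≢ x y neq with f x ≟ y
  ... | yes eq = contradiction eq neq
  ... | no _  = refl
  h-0 : ∀ x y → g y ≡ 0ℤ → h x y ≡ 0ℤ
  h-0 x y eq with f x ≟ y
  ... | yes _ = eq
  ... | no _  = refl
  row : ∀ x → ∑ ys (h x) ≡ g (f x)
  row x = trans (∑-single eys (f x) (λ y y≢ → h-≢ x y (≢-sym y≢))) (h-≡ x)
  column : ∀ y → ∑ xs (λ x → h x y) ≡ g y
  column y with supp y
  ... | inj₁ g≡0        = trans (trans (∑-cong xs (λ x → h-0 x y g≡0)) (∑-zero xs)) (sym g≡0)
  ... | inj₂ (x , refl) =
    trans (∑-single exs x (λ x′ x′≢x → h-≢ x′ (f x) (x′≢x ∘ inj))) (h-≡ x)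

-- Subsets of ℕ as refinement types

module _ {P : Pred ℕ 0ℓ} (P? : Decidable P) where

  value-injective : {x y : Refinement ℕ P} → value x ≡ value y → x ≡ y
  value-injective refl = refl

  witness : (x : Refinement ℕ P) → P (value x)
  witness (n , [ p ]) = recompute (P? n) p

  select-all : ∀ {Q : Pred ℕ 0ℓ} {xs} → All Q xs → All (Q ∘ value) (mapMaybe (select P?) xs)
  select-all []                   = []
  select-all {xs = x ∷ _} (q ∷ qs) with P? x
  ... | yes _ = q ∷ select-all qs
  ... | no  _ = select-all qs

  select-unique : ∀ {xs} → Unique xs → Unique (mapMaybe (select P?) xs)
  select-unique []                         = []
  select-unique {x ∷ xs} (x≢xs ∷ xs!) with P? x
  ... | yes p = All.map (λ x≢y eq → x≢y (cong value eq)) (select-all x≢xs) ∷ select-unique xs!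
  ... | no  _ = select-unique xs!

  select-∈ : ∀ {xs} (a : Refinement ℕ P) → value a ∈ xs → a ∈ mapMaybe (select P?) xs
  select-∈ a (here {x} refl) with P? x
  ... | yes _ = here refl
  ... | no ¬p = contradiction (witness a) ¬p
  select-∈ a (there {x} a∈) with P? x
  ... | yes _ = there (select-∈ a a∈)
  ... | no  _ = select-∈ a a∈

  elements-enumerates : ∀ M → (∀ {n} → P n → n ℕ.≤ M) → Enumerates (elements P? M)
  elements-enumerates M bound =
    select-unique (upTo⁺ (suc M)) , λ a → select-∈ a (∈-upTo⁺ (s≤s (bound (witness a))))

-- Congruences

infix 4 _≡_[mod_]
-- An equation for `a` rather than divisibility of `a - b`: matching it with `refl` eliminates `a`,
-- so that compatibility with the operations becomes a ring identity.
record _≡_[mod_] (a b k : ℤ) : Set where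
  constructor by
  field
    multiple : ℤ
    equation : a ≡ b + multiple * k

module _ {k : ℤ} where

  mod-reflexive : ∀ {a b} → a ≡ b → a ≡ b [mod k ]
  mod-reflexive {a} refl = by 0ℤ (sym (ℤᵖ.+-identityʳ a))

  mod-trans : ∀ {a b c} → a ≡ b [mod k ] → b ≡ c [mod k ] → a ≡ c [mod k ]
  mod-trans {c = c} (by x refl) (by y refl) = by (y + x) (lem c x y k)
    where
    lem : ∀ c x y k → c + y * k + x * k ≡ c + (y + x) * k
    lem = solve-∀

  mod-sym : ∀ {a b} → a ≡ b [mod k ] → b ≡ a [mod k ]
  mod-sym {b = b} (by x refl) = by (- x) (lem b x k)
    where
    lem : ∀ b x k → b ≡ b + x * k + - x * k
    lem = solve-∀

  mod-+ : ∀ {a b c d} → a ≡ b [mod k ] → c ≡ d [mod k ] → a + c ≡ b + d [mod k ]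
  mod-+ {b = b} {d = d} (by x refl) (by y refl) = by (x + y) (lem b d x y k)
    where
    lem : ∀ b d x y k → b + x * k + (d + y * k) ≡ b + d + (x + y) * k
    lem = solve-∀

  mod-* : ∀ {a b c d} → a ≡ b [mod k ] → c ≡ d [mod k ] → a * c ≡ b * d [mod k ]
  mod-* {b = b} {d = d} (by x refl) (by y refl) = by (x * d + b * y + x * y * k) (lem b d x y k)
    where
    lem : ∀ b d x y k → (b + x * k) * (d + y * k) ≡ b * d + (x * d + b * y + x * y * k) * k
    lem = solve-∀

  mod-neg : ∀ {a b} → a ≡ b [mod k ] → - a ≡ - b [mod k ]
  mod-neg {b = b} (by x refl) = by (- x) (lem b x k)
    where
    lem : ∀ b x k → - (b + x * k) ≡ - b + - x * k
    lem = solve-∀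

  mod-- : ∀ {a b c d} → a ≡ b [mod k ] → c ≡ d [mod k ] → a - c ≡ b - d [mod k ]
  mod-- p q = mod-+ p (mod-neg q)

  mod-*ˡ : ∀ a {c d} → c ≡ d [mod k ] → a * c ≡ a * d [mod k ]
  mod-*ˡ a = mod-* (mod-reflexive {a} refl)

  ∣⇒mod : ∀ {a} → k ∣ a → a ≡ 0ℤ [mod k ]
  ∣⇒mod (divides x eq) = by x (trans eq (sym (ℤᵖ.+-identityˡ (x * k))))

  mod⇒∣ : ∀ {a} → a ≡ 0ℤ [mod k ] → k ∣ a
  mod⇒∣ (by x eq) = divides x (trans eq (ℤᵖ.+-identityˡ (x * k)))

  mod-∣ : ∀ {a b} → a ≡ b [mod k ] → k ∣ b → k ∣ a
  mod-∣ p d = mod⇒∣ (mod-trans p (∣⇒mod d))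

  ∑-mod : ∀ {A : Set} (xs : List A) {f g} → (∀ x → f x ≡ g x [mod k ]) → ∑ xs f ≡ ∑ xs g [mod k ]
  ∑-mod []       p = mod-reflexive refl
  ∑-mod (x ∷ xs) p = mod-+ (p x) (∑-mod xs p)

-- Parities, and squares of units modulo 8 and 3

odd⇒≡1 : ∀ {z} → Odd z → z ≡ 1ℤ [mod + 2 ]
odd⇒≡1 {z} odd with z ℤ.%ℕ 2 | a≡a%ℕn+[a/ℕn]*n z 2 | n%ℕd<d z 2
... | 0 | z≡ | _ = contradiction (divides (z ℤ./ℕ 2) (trans z≡ (ℤᵖ.+-identityˡ _))) odd
... | 1 | z≡ | _ = by (z ℤ./ℕ 2) z≡
... | suc (suc _) | _ | s≤s (s≤s ())

-- Modulo 2 an odd coefficient is 1 and an even one is 0, so selecting the odd entries amounts to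
-- multiplying by them. This linearises both the square condition and the parity conditions of (S).
oddSum-parity : ∀ {A : Set} (w : A → ℕ) (c : A → ℤ) (xs : List A) →
                + sum (map w (filter (λ x → odd? (c x)) xs)) ≡ ∑ xs (λ x → + w x * c x) [mod + 2 ]
oddSum-parity w c []       = mod-reflexive refl
oddSum-parity w c (x ∷ xs) with + 2 ℤᵈ.∣? c x
... | yes even = mod-trans
  (mod-reflexive (trans (cong (+_ ∘ sum ∘ map w) (filter-reject (odd? ∘ c) (contradiction even)))
    (sym (trans (cong (_+ _) (ℤᵖ.*-zeroʳ (+ w x))) (ℤᵖ.+-identityˡ _)))))
  (mod-+ (mod-*ˡ (+ w x) (mod-sym (∣⇒mod even))) (oddSum-parity w c xs))
... | no odd = mod-trans
  (mod-reflexive (trans (cong (+_ ∘ sum ∘ map w) (filter-accept (odd? ∘ c) odd))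
    (sym (cong (_+ _) (ℤᵖ.*-identityʳ (+ w x))))))
  (mod-+ (mod-*ˡ (+ w x) (mod-sym (odd⇒≡1 odd))) (oddSum-parity w c xs))

odd⇒2∣z-1 : ∀ {z} → Odd z → + 2 ∣ z - 1ℤ
odd⇒2∣z-1 odd with by t refl ← odd⇒≡1 odd = divides t (lem t)
  where
  lem : ∀ t → 1ℤ + t * + 2 - 1ℤ ≡ t * + 2
  lem = solve-∀

-- With z = 1 + 2t one has z² - 1 = 4t(t + 1); the parity of t decides which factor supplies the
-- last 2.
odd⇒8∣z²-1 : ∀ {z} → Odd z → + 8 ∣ z * z - 1ℤ
odd⇒8∣z²-1 odd with by t refl ← odd⇒≡1 odd with + 2 ℤᵈ.∣? t
... | yes (divides s refl) = divides (s * (+ 1 + + 2 * s)) (lem s)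
  where
  lem : ∀ s → (1ℤ + s * + 2 * + 2) * (1ℤ + s * + 2 * + 2) - 1ℤ ≡ s * (+ 1 + + 2 * s) * + 8
  lem = solve-∀
... | no odd-t with by s refl ← odd⇒≡1 odd-t = divides ((+ 1 + + 2 * s) * (+ 1 + s)) (lem s)
  where
  lem : ∀ s → (1ℤ + (1ℤ + s * + 2) * + 2) * (1ℤ + (1ℤ + s * + 2) * + 2) - 1ℤ ≡ (+ 1 + + 2 * s) * (+ 1 + s) * + 8
  lem = solve-∀

3∤z⇒3∣z²-1 : ∀ {z} → ¬ + 3 ∣ z → + 3 ∣ z * z - 1ℤ
3∤z⇒3∣z²-1 {z} 3∤z with z ℤ.%ℕ 3 | a≡a%ℕn+[a/ℕn]*n z 3 | n%ℕd<d z 3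
... | 0 | z≡ | _ = contradiction (divides (z ℤ./ℕ 3) (trans z≡ (ℤᵖ.+-identityˡ _))) 3∤z
... | 1 | z≡ | _ = divides (+ 2 * t + + 3 * t * t) (trans (cong (λ x → x * x - 1ℤ) z≡) (lem t))
  where
  t = z ℤ./ℕ 3
  lem : ∀ t → (+ 1 + t * + 3) * (+ 1 + t * + 3) - 1ℤ ≡ (+ 2 * t + + 3 * t * t) * + 3
  lem = solve-∀
... | 2 | z≡ | _ = divides (+ 1 + + 4 * t + + 3 * t * t) (trans (cong (λ x → x * x - 1ℤ) z≡) (lem t))
  where
  t = z ℤ./ℕ 3
  lem : ∀ t → (+ 2 + t * + 3) * (+ 2 + t * + 3) - 1ℤ ≡ (+ 1 + + 4 * t + + 3 * t * t) * + 3
  lem = solve-∀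
... | suc (suc (suc _)) | _ | s≤s (s≤s (s≤s ()))

∤⇒+∤ : ∀ {k n} → ¬ k ℕᵈ.∣ n → ¬ + k ∣ + n
∤⇒+∤ k∤n d = k∤n (ℤᵈ.∣⇒∣ᵤ d)

mod-step : ∀ {k a b d} x → k ∣ d → a ≡ b + d * x → a ≡ b [mod k ]
mod-step {k} {b = b} x (divides s refl) eq = by (s * x) (trans eq (lem b s k x))
  where
  lem : ∀ b s k x → b + s * k * x ≡ b + s * x * k
  lem = solve-∀

gap : ∀ {x y n} → 0ℤ ℤ.≤ y → y ℤ.< x → x ℤ.< + n → ∃ λ m → x - y ≡ + suc m × suc m ℕ.< n
gap {+ x} {+ y} _ (ℤ.+<+ y<x) (ℤ.+<+ x<n) with ℕᵖ.m≤n⇒∃[o]m+o≡n y<x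
... | m , refl = m , lem (+ y) (+ m) , ℕᵖ.≤-<-trans (s≤s (ℕᵖ.m≤n+m m y)) x<n
  where
  lem : ∀ y m → + 1 + (y + m) - y ≡ + 1 + m
  lem = solve-∀

-- Valuations

largest-max : ∀ {P : Pred ℕ 0ℓ} (P? : Decidable P) M {k} → P k → k ℕ.≤ M → k ℕ.≤ largest P? M
largest-max P? zero    p k≤M = k≤M
largest-max P? (suc M) {k} p k≤M with P? (suc M)
... | yes _ = k≤M
... | no ¬p with ℕᵖ.m≤n⇒m<n∨m≡n k≤M
...   | inj₁ (s≤s k≤M′) = largest-max P? M p k≤M′
...   | inj₂ refl       = contradiction p ¬p

n<m^n : ∀ m .{{_ : NonTrivial m}} n → n ℕ.< m ^ n
n<m^n m       zero    = s≤s z≤n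
n<m^n m@(suc (suc k)) (suc n) = begin-strict
  suc n             ≤⟨ n<m^n m n ⟩
  m ^ n             <⟨ ℕᵖ.m<m+n (m ^ n) (ℕᵖ.≤-trans (s≤s z≤n) (n<m^n m n)) ⟩
  m ^ n ℕ.+ m ^ n   ≤⟨ ℕᵖ.+-monoʳ-≤ (m ^ n) (ℕᵖ.m≤m+n (m ^ n) (k ℕ.* m ^ n)) ⟩
  m ℕ.* m ^ n       ∎
  where open ℕᵖ.≤-Reasoning

-- Shows that the bounded searches defining `v` and `exponents` miss nothing.
∣⇒exponent≤ : ∀ p .{{_ : NonTrivial p}} {k n} .{{_ : NonZero n}} → p ^ k ℕᵈ.∣ n → k ℕ.≤ n
∣⇒exponent≤ p {k} d = ℕᵖ.<⇒≤ (ℕᵖ.<-≤-trans (n<m^n p k) (ℕᵈ.∣⇒≤ d))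

*-nonZero : ∀ {m n} → NonZero m → NonZero n → NonZero (m ℕ.* n)
*-nonZero {suc _} {suc _} _ _ = _

*-nonZero⁻ˡ : ∀ m {n} → NonZero (m ℕ.* n) → NonZero m
*-nonZero⁻ˡ (suc _) _ = _

*-nonZero⁻ʳ : ∀ m {n} → NonZero (m ℕ.* n) → NonZero n
*-nonZero⁻ʳ m {n} nz = *-nonZero⁻ˡ n (subst NonZero (ℕᵖ.*-comm m n) nz)

product-nonZero : ∀ {xs} → All NonZero xs → NonZero (product xs)
product-nonZero []         = _
product-nonZero (nz ∷ nzs) = *-nonZero nz (product-nonZero nzs)

module _ {p : ℕ} (pp : Prime p) where

  private instance
    p≢0 : NonZero p
    p≢0 = prime⇒nonZero pp
    p≢1 : NonTrivial p
    p≢1 = prime⇒nonTrivial pp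

  p∤1 : ¬ p ℕᵈ.∣ 1
  p∤1 d = ¬prime[1] (subst Prime (ℕᵈ.∣1⇒≡1 d) pp)

  v-max : ∀ {n k} → NonZero n → p ^ k ℕᵈ.∣ n → k ℕ.≤ v p n
  v-max {n} nz d = largest-max (λ k → p ^ k ℕᵈ.∣? n) n d (∣⇒exponent≤ p {{p≢1}} {{nz}} d)

  v-unique : ∀ {n a u} → NonZero n → n ≡ p ^ a ℕ.* u → ¬ p ℕᵈ.∣ u → v p n ≡ a
  v-unique {n} {a} {u} nz eq p∤u = ℕᵖ.≤-antisym (ℕᵖ.≮⇒≥ a≮v) (v-max nz (divides u (trans eq (ℕᵖ.*-comm (p ^ a) u))))
    where
    a≮v : ¬ a ℕ.< v p n
    a≮v a<v = p∤u (ℕᵈ.*-cancelˡ-∣ (p ^ a) {{ℕᵖ.m^n≢0 p a}} (subst₂ ℕᵈ._∣_ (ℕᵖ.*-comm p (p ^ a)) eq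
      (∣-trans (^-∣-^ p a<v) (^-v-∣ p n))))

  v-split : ∀ {n} → NonZero n → ∃ λ u → n ≡ p ^ v p n ℕ.* u × ¬ p ℕᵈ.∣ u
  v-split {n} nz with divides u eq ← ^-v-∣ p n =
    u , n≡ , λ { (divides w eq′) → ℕᵖ.1+n≰n (v-max nz (divides w (begin
      n                               ≡⟨ n≡ ⟩
      p ^ v p n ℕ.* u                 ≡⟨ cong (p ^ v p n ℕ.*_) eq′ ⟩
      p ^ v p n ℕ.* (w ℕ.* p)         ≡⟨ rearrange (p ^ v p n) w p ⟩
      w ℕ.* (p ℕ.* p ^ v p n)         ∎))) }
    where
    open ≡-Reasoning
    n≡ : n ≡ p ^ v p n ℕ.* u
    n≡ = trans eq (ℕᵖ.*-comm u (p ^ v p n))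
    rearrange : ∀ a b c → a ℕ.* (b ℕ.* c) ≡ b ℕ.* (c ℕ.* a)
    rearrange = solveℕ-∀

  v-∤ : ∀ {n} → NonZero n → ¬ p ℕᵈ.∣ n → v p n ≡ 0
  v-∤ {n} nz = v-unique nz (sym (ℕᵖ.+-identityʳ n))

  v-1 : v p 1 ≡ 0
  v-1 = v-∤ _ p∤1

  v-* : ∀ {m n} → NonZero m → NonZero n → v p (m ℕ.* n) ≡ v p m ℕ.+ v p n
  v-* {m} {n} m≢0 n≢0 with v-split m≢0 | v-split n≢0
  ... | x , m≡ , p∤x | y , n≡ , p∤y = v-unique (*-nonZero m≢0 n≢0) mn≡ p∤xy
    where
    open ≡-Reasoning
    p∤xy : ¬ p ℕᵈ.∣ x ℕ.* y
    p∤xy d with euclidsLemma x y pp d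
    ... | inj₁ d′ = p∤x d′
    ... | inj₂ d′ = p∤y d′
    interchange : ∀ a b c d → a ℕ.* b ℕ.* (c ℕ.* d) ≡ a ℕ.* c ℕ.* (b ℕ.* d)
    interchange = solveℕ-∀
    mn≡ : m ℕ.* n ≡ p ^ (v p m ℕ.+ v p n) ℕ.* (x ℕ.* y)
    mn≡ = begin
      m ℕ.* n                                         ≡⟨ cong₂ ℕ._*_ m≡ n≡ ⟩
      p ^ v p m ℕ.* x ℕ.* (p ^ v p n ℕ.* y)           ≡⟨ interchange (p ^ v p m) x (p ^ v p n) y ⟩
      p ^ v p m ℕ.* p ^ v p n ℕ.* (x ℕ.* y)           ≡⟨ cong (ℕ._* (x ℕ.* y)) (ℕᵖ.^-distribˡ-+-* p (v p m) (v p n)) ⟨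
      p ^ (v p m ℕ.+ v p n) ℕ.* (x ℕ.* y)             ∎

  v-^ : ∀ {m} → NonZero m → ∀ a → v p (m ^ a) ≡ a ℕ.* v p m
  v-^ m≢0 zero    = v-1
  v-^ {m} m≢0 (suc a) = trans (v-* m≢0 (ℕᵖ.m^n≢0 m a {{m≢0}})) (cong (v p m ℕ.+_) (v-^ m≢0 a))

  v-self : v p p ≡ 1
  v-self = v-unique p≢0 (sym (trans (ℕᵖ.*-identityʳ (p ^ 1)) (ℕᵖ.*-identityʳ p))) p∤1

  v-self-^ : ∀ a → v p (p ^ a) ≡ a
  v-self-^ a = trans (v-^ p≢0 a) (trans (cong (a ℕ.*_) v-self) (ℕᵖ.*-identityʳ a))

  ∤-prime : ∀ {q} → Prime q → p ≢ q → ¬ p ℕᵈ.∣ q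
  ∤-prime qq p≢q d with prime⇒irreducible qq d
  ... | inj₁ p≡1 = ¬prime[1] (subst Prime p≡1 pp)
  ... | inj₂ p≡q = p≢q p≡q

  v-prime-^ : ∀ {q} → Prime q → p ≢ q → ∀ a → v p (q ^ a) ≡ 0
  v-prime-^ qq p≢q a = trans (v-^ (prime⇒nonZero qq) a)
    (trans (cong (a ℕ.*_) (v-∤ (prime⇒nonZero qq) (∤-prime qq p≢q))) (ℕᵖ.*-zeroʳ a))

  v-product : ∀ {xs} → All NonZero xs → v p (product xs) ≡ sum (map (v p) xs)
  v-product []                = v-1
  v-product {x ∷ _} (nz ∷ nzs) = trans (v-* nz (product-nonZero nzs)) (cong (v p x ℕ.+_) (v-product nzs))

  v-square : ∀ {k} → NonZero k → 2 ℕᵈ.∣ v p (k ℕ.* k)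
  v-square {k} nz = divides (v p k) (trans (v-* nz nz) (double (v p k)))
    where
    double : ∀ a → a ℕ.+ a ≡ a ℕ.* 2
    double = solveℕ-∀

prime-divisor : ∀ n .{{_ : NonZero n}} → n ≡ 1 ⊎ ∃ λ p → Prime p × p ℕᵈ.∣ n
prime-divisor n with factorise n
... | record { factors = [] ; isFactorisation = eq } = inj₁ eq
... | record { factors = p ∷ ps ; isFactorisation = eq ; factorsPrime = pp ∷ _ } =
  inj₂ (p , pp , divides (product ps) (trans eq (ℕᵖ.*-comm p (product ps))))

-- Strong induction, removing a square p² at a time: a prime dividing n has positive even valuation,
-- hence at least 2, and dividing by p² keeps all valuations even.
evenValuations⇒square : ∀ n → NonZero n → (∀ {p} → Prime p → 2 ℕᵈ.∣ v p n) → PerfectSquare n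
evenValuations⇒square = <-rec _ step
  where
  Goal : ℕ → Set
  Goal n = NonZero n → (∀ {p} → Prime p → 2 ℕᵈ.∣ v p n) → PerfectSquare n
  step : ∀ n → (∀ {m} → m ℕ.< n → Goal m) → Goal n
  step n rec nz ev with prime-divisor n {{nz}}
  ... | inj₁ refl = 1 , refl
  ... | inj₂ (p , pp , p∣n) = p ℕ.* proj₁ root , (begin
      n                                          ≡⟨ n≡ ⟩
      m ℕ.* (p ℕ.* p)                            ≡⟨ cong (ℕ._* (p ℕ.* p)) (proj₂ root) ⟩
      proj₁ root ℕ.* proj₁ root ℕ.* (p ℕ.* p)    ≡⟨ interchange (proj₁ root) p ⟩
      p ℕ.* proj₁ root ℕ.* (p ℕ.* proj₁ root)    ∎)
    where
    open ≡-Reasoning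
    interchange : ∀ k p → k ℕ.* k ℕ.* (p ℕ.* p) ≡ p ℕ.* k ℕ.* (p ℕ.* k)
    interchange = solveℕ-∀
    1≤v : 1 ℕ.≤ v p n
    1≤v = v-max pp nz (subst (ℕᵈ._∣ n) (sym (ℕᵖ.*-identityʳ p)) p∣n)
    2≤v : 2 ℕ.≤ v p n
    2≤v = ℕᵈ.∣⇒≤ {{ℕ.>-nonZero 1≤v}} (ev pp)
    p²∣n : p ^ 2 ℕᵈ.∣ n
    p²∣n = ∣-trans (^-∣-^ p 2≤v) (^-v-∣ p n)
    m : ℕ
    m = ℕᵈ.quotient p²∣n
    n≡ : n ≡ m ℕ.* (p ℕ.* p)
    n≡ = trans (ℕᵈ._∣_.equality p²∣n) (cong (λ x → m ℕ.* (p ℕ.* x)) (ℕᵖ.*-identityʳ p))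
    p≢0 = prime⇒nonZero pp
    m≢0 : NonZero m
    m≢0 = *-nonZero⁻ˡ m (subst NonZero n≡ nz)
    p²≢0 : NonZero (p ℕ.* p)
    p²≢0 = *-nonZero p≢0 p≢0
    1<p : 1 ℕ.< p
    1<p = ℕ.nonTrivial⇒n>1 p {{prime⇒nonTrivial pp}}
    m<n : m ℕ.< n
    m<n = subst (m ℕ.<_) (sym n≡) (ℕᵖ.m<m*n m (p ℕ.* p) {{m≢0}} (ℕᵖ.<-≤-trans 1<p (ℕᵖ.m≤m*n p p {{p≢0}})))
    ev′ : ∀ {q} → Prime q → 2 ℕᵈ.∣ v q m
    ev′ {q} qq = ℕᵈ.∣m+n∣m⇒∣n (subst (2 ℕᵈ.∣_) (trans (cong (v q) n≡)
      (trans (v-* qq m≢0 p²≢0) (ℕᵖ.+-comm (v q m) _))) (ev qq)) (v-square qq p≢0)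
    root : PerfectSquare m
    root = rec m<n m≢0 ev′

square⇒evenValuations : ∀ {n} → NonZero n → PerfectSquare n → ∀ {p} → Prime p → 2 ℕᵈ.∣ v p n
square⇒evenValuations nz (k , refl) pp = v-square pp (*-nonZero⁻ˡ k nz)

∤-^ : ∀ {p q} → Prime p → Prime q → p ≢ q → ∀ a → ¬ p ℕᵈ.∣ q ^ a
∤-^ pp qq p≢q zero    d = p∤1 pp d
∤-^ {p} {q} pp qq p≢q (suc a) d with euclidsLemma q (q ^ a) pp d
... | inj₁ d′ = ∤-prime pp qq p≢q d′
... | inj₂ d′ = ∤-^ pp qq p≢q a d′

-- The set 𝓑_N

prime[3] : Prime 3
prime[3] = toWitness {a? = prime? 3} _

-- The last component is what lets the functional at a prime p other than 2 and 3 read off the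
-- single coefficient c_p.
PrimePower : ℕ → Set
PrimePower n = ∃₂ λ q β → Prime q × n ≡ q ^ β × (q ≢ 2 → q ≢ 3 → β ≡ 1)

𝓑²-primePower : ∀ α → All PrimePower (𝓑² α)
𝓑²-primePower α = All.map (λ (β , eq) → 2 , β , prime[2] , eq , λ 2≢2 _ → contradiction refl 2≢2) (powers α)
  where
  powers : ∀ α → All (λ n → ∃ λ β → n ≡ 2 ^ β) (𝓑² α)
  powers 0 = []
  powers 1 = (1 , refl) ∷ []
  powers 2 = (1 , refl) ∷ (2 , refl) ∷ []
  powers (suc (suc (suc α))) = (1 ℕ.+ α , refl) ∷ (2 ℕ.+ α , refl) ∷ (3 ℕ.+ α , refl) ∷ []

𝓑³-primePower : ∀ α → All PrimePower (𝓑³ α)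
𝓑³-primePower α = All.map (λ (β , eq) → 3 , β , prime[3] , eq , λ _ 3≢3 → contradiction refl 3≢3) (powers α)
  where
  powers : ∀ α → All (λ n → ∃ λ β → n ≡ 3 ^ β) (𝓑³ α)
  powers 0 = []
  powers 1 = (1 , refl) ∷ []
  powers (suc (suc α)) = (1 ℕ.+ α , refl) ∷ (2 ℕ.+ α , refl) ∷ []

𝓑ᵖ-large : ∀ N p → p ≢ 2 → p ≢ 3 → 𝓑ᵖ N p ≡ p ∷ []
𝓑ᵖ-large N 0 _ _ = refl
𝓑ᵖ-large N 1 _ _ = refl
𝓑ᵖ-large N 2 2≢2 _ = contradiction refl 2≢2
𝓑ᵖ-large N 3 _ 3≢3 = contradiction refl 3≢3
𝓑ᵖ-large N (suc (suc (suc (suc _)))) _ _ = refl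

𝓑ᵖ-primePower : ∀ N {p} → Prime p → All PrimePower (𝓑ᵖ N p)
𝓑ᵖ-primePower N {p} pp with p ℕᵖ.≟ 2 | p ℕᵖ.≟ 3
... | yes refl | _        = 𝓑²-primePower (v 2 N)
... | no _     | yes refl = 𝓑³-primePower (v 3 N)
... | no p≢2   | no p≢3   = subst (All PrimePower) (sym (𝓑ᵖ-large N p p≢2 p≢3))
  ((p , 1 , pp , sym (ℕᵖ.*-identityʳ p) , λ _ _ → refl) ∷ [])

𝓑-primePower : ∀ N {n} → n ∈ 𝓑-list N → PrimePower n
𝓑-primePower N = All.lookup (concat⁺ (map⁺ (All.map (𝓑ᵖ-primePower N ∘ proj₁)
  (all-filter (λ p → prime? p ×-dec p ℕᵈ.∣? N) (upTo (suc N))))))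

parity : ∀ m → ∃ λ j → m ≡ j ℕ.+ j ⊎ m ≡ suc (j ℕ.+ j)
parity zero = 0 , inj₁ refl
parity (suc m) with parity m
... | j , inj₁ eq = j , inj₂ (cong suc eq)
... | j , inj₂ eq = suc j , inj₁ (cong suc (trans eq (sym (ℕᵖ.+-suc j j))))

odd-power : ∀ p j → p ^ suc (j ℕ.+ j) ≡ p ℕ.* (p ^ j ℕ.* p ^ j)
odd-power p j = cong (p ℕ.*_) (ℕᵖ.^-distribˡ-+-* p j j)

-- Among consecutive exponents one is odd. The form p · y² is the one from which `reached-/²`
-- recovers p itself.
odd-power∈𝓑² : ∀ α → ∃ λ j → 2 ℕ.* (2 ^ j ℕ.* 2 ^ j) ∈ 𝓑² (suc α)
odd-power∈𝓑² 0 = 0 , here refl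
odd-power∈𝓑² 1 = 0 , here refl
odd-power∈𝓑² (suc (suc m)) with parity m
... | j , inj₁ refl = j , here (sym (odd-power 2 j))
... | j , inj₂ refl = suc j , there (here (trans (sym (odd-power 2 (suc j))) (cong (λ x → 2 ^ (2 ℕ.+ x)) (ℕᵖ.+-suc j j))))

odd-power∈𝓑³ : ∀ α → ∃ λ j → 3 ℕ.* (3 ^ j ℕ.* 3 ^ j) ∈ 𝓑³ (suc α)
odd-power∈𝓑³ 0 = 0 , here refl
odd-power∈𝓑³ (suc m) with parity m
... | j , inj₁ refl = j , here (sym (odd-power 3 j))
... | j , inj₂ refl = suc j , there (here (trans (sym (odd-power 3 (suc j))) (cong (λ x → 3 ^ (2 ℕ.+ x)) (ℕᵖ.+-suc j j))))

-- The orders at the cusps ∞ and 0 and the parities of the p-adic valuations of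
-- the square condition: together with the degree, these cut out Z(N) in ℤ^𝓓(N).
data Place : Set where
  ∞  : Place
  𝟎  : Place
  at : ∀ p → Prime p → Place

-- The pair (k, l) is (24, 2) for Z(N), and (8, 2) and (3, 1) for its coprime parts; l = 1 makes the
-- parities void.
modulus : (k l : ℤ) → Place → ℤ
modulus k l ∞        = k
modulus k l 𝟎        = k
modulus k l (at _ _) = l

weight : ∀ {N} → Place → 𝓓 N → ℤ
weight ∞        n = + value n
weight 𝟎        n = + codivisor n
weight (at p _) n = + v p (value n)

-- Membership in Z(N) and the system (S) as vanishing of linear functionals

module Functionals (N : ℕ) (N≢0 : NonZero N) where

  𝓑ᵖ⊆𝓑 : ∀ {p n} → Prime p → p ℕᵈ.∣ N → n ∈ 𝓑ᵖ N p → n ∈ 𝓑-list N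
  𝓑ᵖ⊆𝓑 {p} {n} pp p∣N n∈ = ∈-concatMap⁺ (𝓑ᵖ N) (Any.map (λ { refl → n∈ })
    (∈-filter⁺ (λ p → prime? p ×-dec p ℕᵈ.∣? N) (∈-upTo⁺ (s≤s (ℕᵈ.∣⇒≤ {{N≢0}} p∣N))) (pp , p∣N)))

  large∈𝓑 : ∀ {p} → Prime p → p ℕᵈ.∣ N → p ≢ 2 → p ≢ 3 → p ∈ 𝓑-list N
  large∈𝓑 {p} pp p∣N p≢2 p≢3 =
    𝓑ᵖ⊆𝓑 pp p∣N (subst (p ∈_) (sym (𝓑ᵖ-large N p p≢2 p≢3)) (here refl))

  divisors-enumerate : Enumerates (divisors N)
  divisors-enumerate = elements-enumerates (λ n → ℕᵖ.nonZero? n ×-dec n ℕᵈ.∣? N) N (λ (_ , d) → ℕᵈ.∣⇒≤ {{N≢0}} d)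

  𝓑-enumerate : Enumerates (𝓑-elements N)
  𝓑-enumerate = elements-enumerates (λ n → member? ℕᵖ._≟_ n (𝓑-list N)) N
    (λ n∈ → ℕᵈ.∣⇒≤ {{N≢0}} (proj₂ (𝓑-divides N n∈)))

  exponents-enumerate : ∀ {p} → Prime p → Enumerates (exponents p N)
  exponents-enumerate {p} pp = elements-enumerates (λ β → member? ℕᵖ._≟_ (p ^ β) (𝓑-list N)) N
    (λ n∈ → ∣⇒exponent≤ p {{prime⇒nonTrivial pp}} {{N≢0}} (proj₂ (𝓑-divides N n∈)))

  𝓓-witness : (n : 𝓓 N) → PosDivisor N (value n)
  𝓓-witness = witness (λ n → ℕᵖ.nonZero? n ×-dec n ℕᵈ.∣? N)

  𝓑-witness : (n : 𝓑 N) → value n ∈ 𝓑-list N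
  𝓑-witness = witness (λ n → member? ℕᵖ._≟_ n (𝓑-list N))

  _≟𝓑_ : DecidableEquality (𝓑 N)
  x ≟𝓑 y with value x ℕᵖ.≟ value y
  ... | yes eq = yes (value-injective (λ n → member? ℕᵖ._≟_ n (𝓑-list N)) eq)
  ... | no neq = no (neq ∘ cong value)

  infix 5 ⟨_,_⟩
  ⟨_,_⟩ : (𝓓 N → ℤ) → Lattice N → ℤ
  ⟨ w , r ⟩ = ∑ (divisors N) (λ n → w n * r n)

  -- The functional of weight `w` on the vector Σ c_n (e_n - e_1), written without reference to an
  -- ordering of 𝓑_N; the identification is `⟨⟩-vector`.
  L : (𝓓 N → ℤ) → (𝓑 N → ℤ) → ℤ
  L w c = ∑ (𝓑-elements N) (λ n → (w (𝓑⇒𝓓 N n) - w one) * c n)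

  L-+ : ∀ w c d → L w (λ n → c n + d n) ≡ L w c + L w d
  L-+ w c d = trans (∑-cong (𝓑-elements N) (λ n → ℤᵖ.*-distribˡ-+ (w (𝓑⇒𝓓 N n) - w one) (c n) (d n)))
                    (∑-+ (𝓑-elements N) (λ n → (w (𝓑⇒𝓓 N n) - w one) * c n) (λ n → (w (𝓑⇒𝓓 N n) - w one) * d n))

  L-* : ∀ w k c → L w (λ n → k * c n) ≡ k * L w c
  L-* w k c = trans (∑-cong (𝓑-elements N) (λ n → swap (w (𝓑⇒𝓓 N n) - w one) k (c n)))
                    (∑-*ˡ (𝓑-elements N) k (λ n → (w (𝓑⇒𝓓 N n) - w one) * c n))
    where
    swap : ∀ a k c → a * (k * c) ≡ k * (a * c)
    swap = solve-∀

  L-- : ∀ w c d → L w (λ n → c n - d n) ≡ L w c - L w d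
  L-- w c d = trans (∑-cong (𝓑-elements N) (λ n → lem (w (𝓑⇒𝓓 N n) - w one) (c n) (d n)))
    (trans (L-+ w c (λ n → - 1ℤ * d n)) (cong (_+_ (L w c)) (trans (L-* w (- 1ℤ) d) (ℤᵖ.-1*i≡-i (L w d)))))
    where
    lem : ∀ w c d → w * (c - d) ≡ w * (c + - 1ℤ * d)
    lem = solve-∀

  L-∑ : ∀ {A : Set} w (xs : List A) (c : A → 𝓑 N → ℤ) →
        L w (λ n → ∑ xs (λ x → c x n)) ≡ ∑ xs (λ x → L w (c x))
  L-∑ w xs c = trans (∑-cong (𝓑-elements N) (λ n → sym (∑-*ˡ xs (w (𝓑⇒𝓓 N n) - w one) (λ x → c x n))))
                     (∑-swap (𝓑-elements N) xs (λ n x → (w (𝓑⇒𝓓 N n) - w one) * c x n))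

  ⟨⟩-⊖ : ∀ w r s → ⟨ w , r ⊖ s ⟩ ≡ ⟨ w , r ⟩ - ⟨ w , s ⟩
  ⟨⟩-⊖ w r s = begin
    ⟨ w , r ⊖ s ⟩                                                ≡⟨ ∑-cong (divisors N) (λ n → expand (w n) (r n) (s n)) ⟩
    ∑ (divisors N) (λ n → w n * r n + - 1ℤ * (w n * s n))        ≡⟨ ∑-+ (divisors N) (λ n → w n * r n) (λ n → - 1ℤ * (w n * s n)) ⟩
    ⟨ w , r ⟩ + ∑ (divisors N) (λ n → - 1ℤ * (w n * s n))        ≡⟨ cong (_+_ ⟨ w , r ⟩) (∑-*ˡ (divisors N) (- 1ℤ) (λ n → w n * s n)) ⟩
    ⟨ w , r ⟩ + - 1ℤ * ⟨ w , s ⟩                                 ≡⟨ cong (_+_ ⟨ w , r ⟩) (ℤᵖ.-1*i≡-i ⟨ w , s ⟩) ⟩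
    ⟨ w , r ⟩ - ⟨ w , s ⟩                                        ∎
    where
    open ≡-Reasoning
    expand : ∀ w r s → w * (r - s) ≡ w * r + - 1ℤ * (w * s)
    expand = solve-∀

  e-≡ : ∀ n → e {N} n n ≡ 1ℤ
  e-≡ n = cong (if_then 1ℤ else 0ℤ) (dec-true (value n ℕᵖ.≟ value n) refl)

  e-≢ : ∀ {n m : 𝓓 N} → m ≢ n → e n m ≡ 0ℤ
  e-≢ {n} {m} m≢n = cong (if_then 1ℤ else 0ℤ) (dec-false (value n ℕᵖ.≟ value m) (λ { refl → m≢n refl }))

  ⟨⟩-e : ∀ w n → ⟨ w , e n ⟩ ≡ w n
  ⟨⟩-e w n = trans
    (∑-single divisors-enumerate {λ m → w m * e n m} n (λ m m≢n → trans (cong (w m *_) (e-≢ m≢n)) (ℤᵖ.*-zeroʳ (w m))))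
    (trans (cong (w n *_) (e-≡ n)) (ℤᵖ.*-identityʳ (w n)))

  ∑≡⟨1,⟩ : ∀ r → ∑ (divisors N) r ≡ ⟨ (λ _ → 1ℤ) , r ⟩
  ∑≡⟨1,⟩ r = ∑-cong (divisors N) (λ n → sym (ℤᵖ.*-identityˡ (r n)))

  module _ {t : ℕ} (b : Ordering N t) where
    open Bijection b using (to; injective; strictlySurjective)

    ⟨⟩-vector : ∀ w c → ⟨ w , vector N b c ⟩ ≡ L w c
    ⟨⟩-vector w c = begin
      ⟨ w , vector N b c ⟩
        ≡⟨ ∑-cong (divisors N) (λ n → expand (w n) (C n) s (e one n)) ⟩
      ∑ (divisors N) (λ n → w n * C n + - s * (w n * e one n))
        ≡⟨ ∑-+ (divisors N) (λ n → w n * C n) (λ n → - s * (w n * e one n)) ⟩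
      ∑ (divisors N) (λ n → w n * C n) + ∑ (divisors N) (λ n → - s * (w n * e one n))
        ≡⟨ cong₂ _+_ main (trans (∑-*ˡ (divisors N) (- s) (λ n → w n * e one n)) (cong (- s *_) (⟨⟩-e w one))) ⟩
      ∑ (allFin t) (λ j → c (to j) * w (𝓑⇒𝓓 N (to j))) + - s * w one
        ≡⟨ cong (_+_ (∑ (allFin t) (λ j → c (to j) * w (𝓑⇒𝓓 N (to j))))) (trans (swap s (w one)) (sym (∑-*ˡ (allFin t) (- w one) (c ∘ to)))) ⟩
      ∑ (allFin t) (λ j → c (to j) * w (𝓑⇒𝓓 N (to j))) + ∑ (allFin t) (λ j → - w one * c (to j))
        ≡⟨ ∑-+ (allFin t) (λ j → c (to j) * w (𝓑⇒𝓓 N (to j))) (λ j → - w one * c (to j)) ⟨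
      ∑ (allFin t) (λ j → c (to j) * w (𝓑⇒𝓓 N (to j)) + - w one * c (to j))
        ≡⟨ ∑-cong (allFin t) (λ j → collect (c (to j)) (w (𝓑⇒𝓓 N (to j))) (w one)) ⟩
      ∑ (allFin t) (λ j → (w (𝓑⇒𝓓 N (to j)) - w one) * c (to j))
        ≡⟨ ∑-reindex _≟𝓑_ (allFin⁺ t , ∈-allFin) 𝓑-enumerate to injective
             (λ n → (w (𝓑⇒𝓓 N n) - w one) * c n) (inj₂ ∘ strictlySurjective) ⟨
      L w c ∎
      where
      open ≡-Reasoning
      C : Lattice N
      C n = ∑ (allFin t) (λ j → c (to j) * e (𝓑⇒𝓓 N (to j)) n)
      s : ℤ
      s = ∑ (allFin t) (λ j → c (to j))
      expand : ∀ w a s e → w * (a - s * e) ≡ w * a + - s * (w * e)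
      expand = solve-∀
      swap : ∀ s w → - s * w ≡ - w * s
      swap = solve-∀
      collect : ∀ c w w₁ → c * w + - w₁ * c ≡ (w - w₁) * c
      collect = solve-∀
      move : ∀ w c e → w * (c * e) ≡ c * (w * e)
      move = solve-∀
      main : ∑ (divisors N) (λ n → w n * C n) ≡ ∑ (allFin t) (λ j → c (to j) * w (𝓑⇒𝓓 N (to j)))
      main = begin
        ∑ (divisors N) (λ n → w n * C n)
          ≡⟨ ∑-cong (divisors N) (λ n → sym (∑-*ˡ (allFin t) (w n) (λ j → c (to j) * e (𝓑⇒𝓓 N (to j)) n))) ⟩
        ∑ (divisors N) (λ n → ∑ (allFin t) (λ j → w n * (c (to j) * e (𝓑⇒𝓓 N (to j)) n)))
          ≡⟨ ∑-swap (divisors N) (allFin t) (λ n j → w n * (c (to j) * e (𝓑⇒𝓓 N (to j)) n)) ⟩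
        ∑ (allFin t) (λ j → ∑ (divisors N) (λ n → w n * (c (to j) * e (𝓑⇒𝓓 N (to j)) n)))
          ≡⟨ ∑-cong (allFin t) (λ j → trans (∑-cong (divisors N) (λ n → move (w n) (c (to j)) (e (𝓑⇒𝓓 N (to j)) n)))
               (trans (∑-*ˡ (divisors N) (c (to j)) (λ n → w n * e (𝓑⇒𝓓 N (to j)) n)) (cong (c (to j) *_) (⟨⟩-e w (𝓑⇒𝓓 N (to j)))))) ⟩
        ∑ (allFin t) (λ j → c (to j) * w (𝓑⇒𝓓 N (to j))) ∎

    -- The degree is the functional of constant weight 1, for which every factor
    -- `w (𝓑⇒𝓓 N n) - w one` in `L` computes to 0.
    vector-S : ∀ c → S N (vector N b c)
    vector-S c = trans (∑≡⟨1,⟩ (vector N b c)) (trans (⟨⟩-vector (λ _ → 1ℤ) c) (∑-zero (𝓑-elements N)))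

  M : Place → ℤ
  M = modulus (+ 24) (+ 2)

  Trivial : Lattice N → Set
  Trivial r = ∀ i → ⟨ weight i , r ⟩ ≡ 0ℤ [mod M i ]

  odds : Lattice N → List ℕ
  odds r = map value (filter (λ n → odd? (r n)) (divisors N))

  odds-nonZero : ∀ r → All NonZero (odds r)
  odds-nonZero r = map⁺ (All.universal (proj₁ ∘ 𝓓-witness) (filter (λ n → odd? (r n)) (divisors N)))

  -- v_p turns the product over the odd entries into a sum, which is linear in `r` modulo 2.
  valuation-parity : ∀ {p} (pp : Prime p) r →
    + v p (product (odds r)) ≡ ⟨ weight (at p pp) , r ⟩ [mod + 2 ]
  valuation-parity {p} pp r = mod-trans
    (mod-reflexive (cong +_ (trans (v-product pp (odds-nonZero r))
                                   (cong sum (sym (map-∘ (filter (λ n → odd? (r n)) (divisors N))))))))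
    (oddSum-parity (v p ∘ value) r (divisors N))

  Z⇒trivial : ∀ {r} → Z N r → Trivial r
  Z⇒trivial z ∞ = ∣⇒mod (Z.order-∞ z)
  Z⇒trivial z 𝟎 = ∣⇒mod (Z.order-0 z)
  Z⇒trivial {r} z (at p pp) = ∣⇒mod (mod-∣ (mod-sym (valuation-parity pp r)) (ℤᵈ.∣ᵤ⇒∣
    (square⇒evenValuations (product-nonZero (odds-nonZero r)) (Z.square z) pp)))

  trivial⇒Z : ∀ {r} → S N r → Trivial r → Z N r
  trivial⇒Z {r} s T = record
    { degree  = s
    ; order-∞ = mod⇒∣ (T ∞)
    ; order-0 = mod⇒∣ (T 𝟎)
    ; square  = evenValuations⇒square (product (odds r)) (product-nonZero (odds-nonZero r))
        (λ pp → ℤᵈ.∣⇒∣ᵤ (mod-∣ (valuation-parity pp r) (mod⇒∣ (T (at _ pp)))))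
    }

  Relation : (𝓑 N → ℤ) → Set
  Relation c = ∀ i → L (weight i) c ≡ 0ℤ [mod M i ]

  codivisor-one : codivisor {N} one ≡ N
  codivisor-one = n/1≡n N

  module _ {p : ℕ} (pp : Prime p) where

    L-at : ∀ c → L (weight (at p pp)) c ≡ ∑ (𝓑-elements N) (λ n → + v p (value n) * c n)
    L-at c = ∑-cong (𝓑-elements N) (λ n → cong (_* c n)
      (trans (cong (λ x → + v p (value n) - + x) (v-1 pp)) (ℤᵖ.+-identityʳ (+ v p (value n)))))

    -- (S) sums over exponents β with p^β in 𝓑_N, `L` over all of 𝓑_N. The sums agree because every
    -- element of 𝓑_N is a prime power and the powers of other primes have valuation 0 at p.
    oddExponentSum-parity : ∀ c → + oddExponentSum p N c ≡ L (weight (at p pp)) c [mod + 2 ]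
    oddExponentSum-parity c = mod-trans (oddSum-parity value (at-power p N c) (exponents p N))
      (mod-reflexive (sym (begin
        L (weight (at p pp)) c
          ≡⟨ L-at c ⟩
        ∑ (𝓑-elements N) (λ n → + v p (value n) * c n)
          ≡⟨ ∑-reindex _≟𝓑_ (exponents-enumerate pp) 𝓑-enumerate toPower toPower-injective
               (λ n → + v p (value n) * c n) support ⟩
        ∑ (exponents p N) (λ β → + v p (p ^ value β) * at-power p N c β)
          ≡⟨ ∑-cong (exponents p N) (λ β → cong (λ x → + x * at-power p N c β) (v-self-^ pp (value β))) ⟩
        ∑ (exponents p N) (λ β → + value β * at-power p N c β) ∎)))
      where
      open ≡-Reasoning
      toPower : Refinement ℕ (λ β → p ^ β ∈ 𝓑-list N) → 𝓑 N
      toPower (β , q) = p ^ β , q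
      toPower-injective : ∀ {x y} → toPower x ≡ toPower y → x ≡ y
      toPower-injective {x} {y} eq = value-injective (λ β → member? ℕᵖ._≟_ (p ^ β) (𝓑-list N))
        (trans (sym (v-self-^ pp (value x))) (trans (cong (v p ∘ value) eq) (v-self-^ pp (value y))))
      support : ∀ n → + v p (value n) * c n ≡ 0ℤ ⊎ ∃ λ β → toPower β ≡ n
      support n with 𝓑-primePower N (𝓑-witness n)
      ... | q , β , qq , n≡ , _ with p ℕᵖ.≟ q
      ...   | no p≢q   = inj₁ (trans (cong (λ x → + x * c n) (trans (cong (v p) n≡) (v-prime-^ pp qq p≢q β))) (ℤᵖ.*-zeroˡ (c n)))
      ...   | yes refl = inj₂ ((β , [ subst (_∈ 𝓑-list N) n≡ (𝓑-witness n) ]) ,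
                value-injective (λ n → member? ℕᵖ._≟_ n (𝓑-list N)) (sym n≡))

    module _ (p≢2 : p ≢ 2) (p≢3 : p ≢ 3) where

      v-off : ∀ (n : 𝓑 N) → value n ≢ p → v p (value n) ≡ 0
      v-off n n≢p with 𝓑-primePower N (𝓑-witness n)
      ... | q , β , qq , n≡ , β≡1 with p ℕᵖ.≟ q
      ...   | no p≢q   = trans (cong (v p) n≡) (v-prime-^ pp qq p≢q β)
      ...   | yes refl = contradiction (trans n≡ (trans (cong (p ^_) (β≡1 p≢2 p≢3)) (ℕᵖ.*-identityʳ p))) n≢p

      term-off : ∀ (c : 𝓑 N → ℤ) (n : 𝓑 N) → value n ≢ p → + v p (value n) * c n ≡ 0ℤ
      term-off c n n≢p = trans (cong (λ x → + x * c n) (v-off n n≢p)) (ℤᵖ.*-zeroˡ (c n))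

      L-large : ∀ c (p∈𝓑 : p ∈ 𝓑-list N) → L (weight (at p pp)) c ≡ c (p , [ p∈𝓑 ])
      L-large c p∈𝓑 = trans (L-at c) (trans
        (∑-single 𝓑-enumerate {λ n → + v p (value n) * c n} (p , [ p∈𝓑 ]) (λ n n≢p → term-off c n
          (n≢p ∘ value-injective (λ n → member? ℕᵖ._≟_ n (𝓑-list N)))))
        (trans (cong (λ x → + x * c (p , [ p∈𝓑 ])) (v-self pp)) (ℤᵖ.*-identityˡ _)))

      L-absent : ∀ c → ¬ p ℕᵈ.∣ N → L (weight (at p pp)) c ≡ 0ℤ
      L-absent c p∤N = trans (L-at c) (trans
        (∑-cong (𝓑-elements N) {λ n → + v p (value n) * c n} (λ n → term-off c n
          (λ { refl → p∤N (proj₂ (𝓑-divides N (𝓑-witness n))) })))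
        (∑-zero (𝓑-elements N)))

  L-𝟎 : ∀ c → ∑ (𝓑-elements N) (λ n → (+ codivisor (𝓑⇒𝓓 N n) - + N) * c n) ≡ L (weight 𝟎) c
  L-𝟎 c = ∑-cong (𝓑-elements N) (λ n → cong (λ x → (+ codivisor (𝓑⇒𝓓 N n) - + x) * c n) (sym codivisor-one))

  -- `Relation` ranges over all primes, whereas (S) imposes evenness only at those dividing N. At a
  -- prime other than 2 and 3 not dividing N the functional is identically 0.
  system⇒relation : ∀ {c} → System N c → Relation c
  system⇒relation s ∞ = ∣⇒mod (System.order-∞ s)
  system⇒relation {c} s 𝟎 = ∣⇒mod (subst (+ 24 ∣_) (L-𝟎 c) (System.order-0 s))
  system⇒relation {c} s (at p pp) with p ℕᵖ.≟ 2 | p ℕᵖ.≟ 3 | p ℕᵈ.∣? N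
  ... | yes refl | _        | _ = ∣⇒mod (mod-∣ (mod-sym (oddExponentSum-parity pp c)) (ℤᵈ.∣ᵤ⇒∣ (System.parity₂ s)))
  ... | no _     | yes refl | _ = ∣⇒mod (mod-∣ (mod-sym (oddExponentSum-parity pp c)) (ℤᵈ.∣ᵤ⇒∣ (System.parity₃ s)))
  ... | no p≢2   | no p≢3   | no p∤N  = mod-reflexive (L-absent pp p≢2 p≢3 c p∤N)
  ... | no p≢2   | no p≢3   | yes p∣N = ∣⇒mod (subst (+ 2 ∣_) (sym (L-large pp p≢2 p≢3 c p∈𝓑))
                                          (System.even s p pp p∣N p≢2 p≢3 p∈𝓑))
    where
    p∈𝓑 = large∈𝓑 pp p∣N p≢2 p≢3

  relation⇒system : ∀ {c} → Relation c → System N c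
  relation⇒system {c} R = record
    { order-∞ = mod⇒∣ (R ∞)
    ; order-0 = subst (+ 24 ∣_) (sym (L-𝟎 c)) (mod⇒∣ (R 𝟎))
    ; even    = λ p pp _ p≢2 p≢3 p∈𝓑 → subst (+ 2 ∣_) (L-large pp p≢2 p≢3 c p∈𝓑) (mod⇒∣ (R (at p pp)))
    ; parity₂ = ℤᵈ.∣⇒∣ᵤ (mod-∣ (oddExponentSum-parity prime[2] c) (mod⇒∣ (R (at 2 prime[2]))))
    ; parity₃ = ℤᵈ.∣⇒∣ᵤ (mod-∣ (oddExponentSum-parity prime[3] c) (mod⇒∣ (R (at 3 prime[3]))))
    }

-- Generation of S(N)/Z(N) by the e_b − e_1

module Generation (N : ℕ) (N≢0 : NonZero N) where
  open Functionals N N≢0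

  Spanned : (k l : ℤ) → (Place → ℤ) → Set
  Spanned k l X = ∃ λ c → ∀ i → L (weight i) c ≡ X i [mod modulus k l i ]

  -- The values of the functionals on e_n − e_1, where q is the codivisor of n.
  target : (n q : ℕ) → Place → ℤ
  target n q ∞        = + n - 1ℤ
  target n q 𝟎        = + q - + N
  target n q (at p _) = + v p n

  -- The codivisor is a variable tied to `n` by an equation, which keeps division out of the ring
  -- identities below.
  Reached : (k l : ℤ) → ℕ → Set
  Reached k l n = ∀ q → N ≡ q ℕ.* n → Spanned k l (target n q)

  codivisor≡ : ∀ (n : 𝓓 N) q → N ≡ q ℕ.* value n → codivisor n ≡ q
  codivisor≡ n@(m , [ d ]) q N≡ = trans (cong (λ x → ℕ._/_ x m {{proj₁ d}}) N≡) (m*n/n≡m q m {{proj₁ d}})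

  target≡ : ∀ n q → N ≡ q ℕ.* value n → ∀ i → weight i n - weight i (one {N}) ≡ target (value n) q i
  target≡ n q N≡ ∞ = refl
  target≡ n q N≡ 𝟎 = cong₂ (λ x y → + x - + y) (codivisor≡ n q N≡) codivisor-one
  target≡ n q N≡ (at p pp) = trans (cong (λ x → + v p (value n) - + x) (v-1 pp)) (ℤᵖ.+-identityʳ (+ v p (value n)))

  factor-nonZero : ∀ {q n} → N ≡ q ℕ.* n → NonZero n
  factor-nonZero {q} eq = *-nonZero⁻ʳ q (subst NonZero eq N≢0)

  module _ {k l : ℤ} where

    spanned-+ : ∀ {X Y} → Spanned k l X → Spanned k l Y → Spanned k l (λ i → X i + Y i)
    spanned-+ (c , p) (d , q) = (λ n → c n + d n) , λ i →
      mod-trans (mod-reflexive (L-+ (weight i) c d)) (mod-+ (p i) (q i))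

    spanned-* : ∀ a {X} → Spanned k l X → Spanned k l (λ i → a * X i)
    spanned-* a (c , p) = (λ n → a * c n) , λ i →
      mod-trans (mod-reflexive (L-* (weight i) a c)) (mod-*ˡ a (p i))

    spanned-resp : ∀ {X Y} → (∀ i → X i ≡ Y i [mod modulus k l i ]) → Spanned k l X → Spanned k l Y
    spanned-resp eq (c , p) = c , λ i → mod-trans (p i) (eq i)

    reached-𝓑 : ∀ {n} → n ∈ 𝓑-list N → Reached k l n
    reached-𝓑 {n} n∈𝓑 q N≡ = δ , λ i → mod-reflexive (trans (L-δ (weight i)) (target≡ (𝓑⇒𝓓 N n′) q N≡ i))
      where
      n′ : 𝓑 N
      n′ = n , [ n∈𝓑 ]
      δ : 𝓑 N → ℤ
      δ m = if does (n ℕᵖ.≟ value m) then 1ℤ else 0ℤ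
      δ-≢ : ∀ m → m ≢ n′ → δ m ≡ 0ℤ
      δ-≢ m m≢n = cong (if_then 1ℤ else 0ℤ) (dec-false (n ℕᵖ.≟ value m) (λ { refl → m≢n refl }))
      L-δ : ∀ w → L w δ ≡ w (𝓑⇒𝓓 N n′) - w one
      L-δ w = trans
        (∑-single 𝓑-enumerate {λ m → (w (𝓑⇒𝓓 N m) - w one) * δ m} n′
          (λ m m≢n → trans (cong ((w (𝓑⇒𝓓 N m) - w one) *_) (δ-≢ m m≢n)) (ℤᵖ.*-zeroʳ (w (𝓑⇒𝓓 N m) - w one))))
        (trans (cong (λ b → (w (𝓑⇒𝓓 N n′) - w one) * (if b then 1ℤ else 0ℤ)) (dec-true (n ℕᵖ.≟ n) refl))
          (ℤᵖ.*-identityʳ (w (𝓑⇒𝓓 N n′) - w one)))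

    reached-1 : Reached k l 1
    reached-1 q N≡ = (λ _ → 0ℤ) , λ i → mod-reflexive (trans (L-0 (weight i)) (sym (zero-target i)))
      where
      L-0 : ∀ w → L w (λ _ → 0ℤ) ≡ 0ℤ
      L-0 w = trans (∑-cong (𝓑-elements N) (λ n → ℤᵖ.*-zeroʳ (w (𝓑⇒𝓓 N n) - w one))) (∑-zero (𝓑-elements N))
      zero-target : ∀ i → target 1 q i ≡ 0ℤ
      zero-target ∞ = refl
      zero-target 𝟎 = trans (cong (λ x → + x - + N) (sym (trans N≡ (ℕᵖ.*-identityʳ q)))) (ℤᵖ.+-inverseʳ (+ N))
      zero-target (at p pp) = cong +_ (v-1 pp)

    -- e_{nm} − e_1 ~ m (e_n − e_1) + (e_m − e_1): the values at ∞ agree exactly, those at 0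
    -- differ by a multiple of m² − 1.
    reached-* : ∀ {n m} → k ∣ + m * + m - 1ℤ → l ∣ + m - 1ℤ →
                Reached k l n → Reached k l m → Reached k l (n ℕ.* m)
    reached-* {n} {m} k∣ l∣ rn rm q N≡ = spanned-resp agree
      (spanned-+ (spanned-* (+ m) (rn (q ℕ.* m) N≡n)) (rm (q ℕ.* n) N≡m))
      where
      N≡n : N ≡ q ℕ.* m ℕ.* n
      N≡n = trans N≡ (lem q n m)
        where
        lem : ∀ q n m → q ℕ.* (n ℕ.* m) ≡ q ℕ.* m ℕ.* n
        lem = solveℕ-∀
      N≡m : N ≡ q ℕ.* n ℕ.* m
      N≡m = trans N≡ (sym (ℕᵖ.*-assoc q n m))
      N≡ℤ : + N ≡ + q * + n * + m
      N≡ℤ = trans (cong +_ N≡m) (trans (ℤᵖ.pos-* (q ℕ.* n) m) (cong (_* + m) (ℤᵖ.pos-* q n)))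
      n≢0 = factor-nonZero {q ℕ.* m} N≡n
      m≢0 = factor-nonZero {q ℕ.* n} N≡m
      agree : ∀ i → + m * target n (q ℕ.* m) i + target m (q ℕ.* n) i ≡ target (n ℕ.* m) q i [mod modulus k l i ]
      agree ∞ = mod-reflexive (trans (lem (+ n) (+ m)) (cong (_- 1ℤ) (sym (ℤᵖ.pos-* n m))))
        where
        lem : ∀ n m → m * (n - 1ℤ) + (m - 1ℤ) ≡ n * m - 1ℤ
        lem = solve-∀
      agree 𝟎 = mod-step (+ q - + q * + n) k∣ (begin
        + m * (+ (q ℕ.* m) - + N) + (+ (q ℕ.* n) - + N)
          ≡⟨ cong₂ (λ x y → + m * (x - + N) + (y - + N)) (ℤᵖ.pos-* q m) (ℤᵖ.pos-* q n) ⟩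
        + m * (+ q * + m - + N) + (+ q * + n - + N)
          ≡⟨ cong (λ x → + m * (+ q * + m - x) + (+ q * + n - x)) N≡ℤ ⟩
        _ ≡⟨ lem (+ q) (+ n) (+ m) ⟩
        _ ≡⟨ cong (λ x → + q - x + (+ m * + m - 1ℤ) * (+ q - + q * + n)) N≡ℤ ⟨
        + q - + N + (+ m * + m - 1ℤ) * (+ q - + q * + n) ∎)
        where
        open ≡-Reasoning
        lem : ∀ q n m → m * (q * m - q * n * m) + (q * n - q * n * m) ≡ q - q * n * m + (m * m - 1ℤ) * (q - q * n)
        lem = solve-∀
      agree (at p pp) = mod-step (+ v p n) l∣ (trans (lem (+ v p n) (+ v p m) (+ m))
        (cong (λ x → + x + (+ m - 1ℤ) * + v p n) (sym (v-* pp n≢0 m≢0))))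
        where
        lem : ∀ vn vm m → m * vn + vm ≡ vn + vm + (m - 1ℤ) * vn
        lem = solve-∀

    -- Since y² ≡ 1 modulo k, passing from x to xy² changes neither x nor the codivisor modulo k,
    -- while valuations change by the even number 2 v_p(y).
    reached-/² : ∀ {x y} → k ∣ + y * + y - 1ℤ → l ∣ + 2 → x ℕ.* (y ℕ.* y) ℕᵈ.∣ N →
                 Reached k l (x ℕ.* (y ℕ.* y)) → Reached k l x
    reached-/² {x} {y} k∣ l∣ (divides q′ N≡′) r q N≡ = spanned-resp agree (r q′ N≡′)
      where
      x≢0 = factor-nonZero {q} N≡
      y²≢0 : NonZero (y ℕ.* y)
      y²≢0 = *-nonZero⁻ʳ x (factor-nonZero {q′} N≡′)
      y≢0 = *-nonZero⁻ˡ y y²≢0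
      q≡ : q ≡ q′ ℕ.* (y ℕ.* y)
      q≡ = ℕᵖ.*-cancelʳ-≡ q (q′ ℕ.* (y ℕ.* y)) x {{x≢0}} (trans (sym N≡) (trans N≡′ (lem q′ x y)))
        where
        lem : ∀ q x y → q ℕ.* (x ℕ.* (y ℕ.* y)) ≡ q ℕ.* (y ℕ.* y) ℕ.* x
        lem = solveℕ-∀
      pos-** : ∀ x → + (x ℕ.* (y ℕ.* y)) ≡ + x * (+ y * + y)
      pos-** x = trans (ℤᵖ.pos-* x (y ℕ.* y)) (cong (+ x *_) (ℤᵖ.pos-* y y))
      agree : ∀ i → target (x ℕ.* (y ℕ.* y)) q′ i ≡ target x q i [mod modulus k l i ]
      agree ∞ = mod-step (+ x) k∣ (trans (cong (_- 1ℤ) (pos-** x)) (lem (+ x) (+ y)))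
        where
        lem : ∀ x y → x * (y * y) - 1ℤ ≡ x - 1ℤ + (y * y - 1ℤ) * x
        lem = solve-∀
      agree 𝟎 = mod-step (- + q′) k∣ (trans (lem (+ q′) (+ y) (+ N))
        (cong (λ z → z - + N + (+ y * + y - 1ℤ) * - + q′) (sym (trans (cong +_ q≡) (pos-** q′)))))
        where
        lem : ∀ q y N → q - N ≡ q * (y * y) - N + (y * y - 1ℤ) * - q
        lem = solve-∀
      agree (at p pp) = mod-step (+ v p y) l∣ (trans
        (cong +_ (trans (v-* pp x≢0 y²≢0) (cong (v p x ℕ.+_) (v-* pp y≢0 y≢0))))
        (lem (+ v p x) (+ v p y)))
        where
        lem : ∀ vx vy → vx + (vy + vy) ≡ vx + + 2 * vy
        lem = solve-∀

    -- Write n as ℓ^a times primes different from ℓ. These are units, so `reached-*` appends them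
    -- one by one to the power of ℓ.
    reached-all : ∀ {ℓ} → Prime ℓ →
      (∀ a → ℓ ^ a ℕᵈ.∣ N → Reached k l (ℓ ^ a)) →
      (∀ {p} → Prime p → p ≢ ℓ → p ℕᵈ.∣ N → Reached k l p) →
      (∀ {p} → ¬ ℓ ℕᵈ.∣ p → (k ∣ + p * + p - 1ℤ) × (l ∣ + p - 1ℤ)) →
      ∀ {n} → n ℕᵈ.∣ N → Reached k l n
    reached-all {ℓ} ℓℓ powers primes units {n} n∣N
      with n≢0 ← factor-nonZero {ℕᵈ.quotient n∣N} (ℕᵈ._∣_.equality n∣N)
      with u , n≡ , ℓ∤u ← v-split ℓℓ n≢0
      with record { factors = ps ; isFactorisation = u≡ ; factorsPrime = primes-ps } ←
             factorise u {{*-nonZero⁻ʳ (ℓ ^ v ℓ n) (subst NonZero n≡ n≢0)}}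
      = subst (Reached k l) (sym n≡′) (go primes-ps (ℓ∤u ∘ subst (ℓ ℕᵈ.∣_) (sym u≡)) (subst (ℕᵈ._∣ N) n≡′ n∣N))
      where
      a = v ℓ n
      n≡′ : n ≡ ℓ ^ a ℕ.* product ps
      n≡′ = trans n≡ (cong (ℓ ^ a ℕ.*_) u≡)
      go : ∀ {ps} → All Prime ps → ¬ ℓ ℕᵈ.∣ product ps →
           ℓ ^ a ℕ.* product ps ℕᵈ.∣ N → Reached k l (ℓ ^ a ℕ.* product ps)
      go [] _ d = subst (Reached k l) (sym (ℕᵖ.*-identityʳ (ℓ ^ a)))
        (powers a (subst (ℕᵈ._∣ N) (ℕᵖ.*-identityʳ (ℓ ^ a)) d))
      go {p ∷ ps} (pp ∷ pps) ℓ∤ d = subst (Reached k l) (sym assoc)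
        (reached-* (proj₁ unit) (proj₂ unit)
          (go pps (ℓ∤ ∘ ℕᵈ.∣n⇒∣m*n p) (∣-trans (ℕᵈ.m∣m*n p) d′))
          (primes pp (λ { refl → ℓ∤ (ℕᵈ.m∣m*n (product ps)) }) (∣-trans (ℕᵈ.n∣m*n (ℓ ^ a ℕ.* product ps)) d′)))
        where
        unit = units {p} (ℓ∤ ∘ ℕᵈ.∣m⇒∣m*n (product ps))
        assoc : ℓ ^ a ℕ.* (p ℕ.* product ps) ≡ ℓ ^ a ℕ.* product ps ℕ.* p
        assoc = lem (ℓ ^ a) p (product ps)
          where
          lem : ∀ x p y → x ℕ.* (p ℕ.* y) ≡ x ℕ.* y ℕ.* p
          lem = solveℕ-∀
        d′ : ℓ ^ a ℕ.* product ps ℕ.* p ℕᵈ.∣ N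
        d′ = subst (ℕᵈ._∣ N) assoc d

  ∣⇒1≤v : ∀ {p} → Prime p → p ℕᵈ.∣ N → 1 ℕ.≤ v p N
  ∣⇒1≤v {p} pp p∣N = v-max pp N≢0 (subst (ℕᵈ._∣ N) (sym (ℕᵖ.*-identityʳ p)) p∣N)

  v≡suc : ∀ {p} → Prime p → p ℕᵈ.∣ N → ∃ λ α → v p N ≡ suc α
  v≡suc {p} pp p∣N with v p N | ∣⇒1≤v pp p∣N
  ... | suc α | s≤s _ = α , refl

  𝓑²⊆𝓑 : ∀ {α n} → 2 ℕᵈ.∣ N → v 2 N ≡ α → n ∈ 𝓑² α → n ∈ 𝓑-list N
  𝓑²⊆𝓑 2∣N refl = 𝓑ᵖ⊆𝓑 prime[2] 2∣N

  𝓑³⊆𝓑 : ∀ {α n} → 3 ℕᵈ.∣ N → v 3 N ≡ α → n ∈ 𝓑³ α → n ∈ 𝓑-list N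
  𝓑³⊆𝓑 3∣N refl = 𝓑ᵖ⊆𝓑 prime[3] 3∣N

  -- The prime 3 itself may be missing from 𝓑_N, but some odd power 3 · 9^j is present, and 9^j is
  -- the square of an odd number. The same argument gives 2 modulo 3 below.
  reached-3-mod8 : 3 ℕᵈ.∣ N → Reached (+ 8) (+ 2) 3
  reached-3-mod8 3∣N with α , α≡ ← v≡suc prime[3] 3∣N with j , ∈𝓑³ ← odd-power∈𝓑³ α =
    reached-/² {x = 3} {3 ^ j} (odd⇒8∣z²-1 (∤⇒+∤ (∤-^ prime[2] prime[3] (λ ()) j))) ℤᵈ.∣-refl
      (proj₂ (𝓑-divides N ∈𝓑)) (reached-𝓑 ∈𝓑)
    where
    ∈𝓑 = 𝓑³⊆𝓑 3∣N α≡ ∈𝓑³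

  reached-2-mod3 : 2 ℕᵈ.∣ N → Reached (+ 3) (+ 1) 2
  reached-2-mod3 2∣N with α , α≡ ← v≡suc prime[2] 2∣N with j , ∈𝓑² ← odd-power∈𝓑² α =
    reached-/² {x = 2} {2 ^ j} (3∤z⇒3∣z²-1 (∤⇒+∤ (∤-^ prime[3] prime[2] (λ ()) j))) (ℤᵈ.∣ᵤ⇒∣ (ℕᵈ.1∣ 2))
      (proj₂ (𝓑-divides N ∈𝓑)) (reached-𝓑 ∈𝓑)
    where
    ∈𝓑 = 𝓑²⊆𝓑 2∣N α≡ ∈𝓑²

  -- Let α = v_3(N). For 0 < b < α the vector of 3^b has value -1 at ∞ and, N and the codivisor both
  -- being divisible by 3, value 0 at 0. Hence 3^(α-1) stands for all of them, and only 3^α is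
  -- separate.
  reached-3^ : ∀ a → 3 ^ a ℕᵈ.∣ N → Reached (+ 3) (+ 1) (3 ^ a)
  reached-3^ zero d = reached-1
  reached-3^ (suc a) d with v 3 N in α≡ | v-max prime[3] {k = suc a} N≢0 d | ^-v-∣ 3 N
  ... | suc zero | s≤s z≤n | _ = reached-𝓑 (𝓑³⊆𝓑 (∣-trans (ℕᵈ.m∣m*n (3 ^ a)) d) α≡ (here refl))
  ... | suc (suc m) | s≤s a≤ | ℕᵈ.divides u N≡u with ℕᵖ.m≤n⇒m<n∨m≡n a≤
  ...   | inj₂ refl = reached-𝓑 (𝓑³⊆𝓑 (∣-trans (ℕᵈ.m∣m*n (3 ^ a)) d) α≡ (there (here refl)))
  ...   | inj₁ (s≤s a≤m) = λ q N≡ → spanned-resp (agree q N≡)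
      (reached-𝓑 (𝓑³⊆𝓑 (∣-trans (ℕᵈ.m∣m*n (3 ^ a)) d) α≡ (here refl)) (u ℕ.* 3) N≡′)
    where
    N≡′ : N ≡ u ℕ.* 3 ℕ.* 3 ^ suc m
    N≡′ = trans N≡u (sym (ℕᵖ.*-assoc u 3 (3 ^ suc m)))
    j = m ℕ.∸ a
    3^m : 3 ^ suc m ≡ 3 ^ j ℕ.* 3 ^ suc a
    3^m = trans (cong (3 ^_) (trans (cong suc (sym (ℕᵖ.m∸n+n≡m a≤m))) (sym (ℕᵖ.+-suc j a))))
                (ℕᵖ.^-distribˡ-+-* 3 j (suc a))
    q≡ : ∀ q → N ≡ q ℕ.* 3 ^ suc a → q ≡ u ℕ.* 3 ^ j ℕ.* 3
    q≡ q N≡ = ℕᵖ.*-cancelʳ-≡ q (u ℕ.* 3 ^ j ℕ.* 3) (3 ^ suc a) {{ℕᵖ.m^n≢0 3 (suc a)}}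
      (trans (sym N≡) (trans N≡′ (trans (cong (u ℕ.* 3 ℕ.*_) 3^m) (lem u (3 ^ j) (3 ^ suc a)))))
      where
      lem : ∀ u x y → u ℕ.* 3 ℕ.* (x ℕ.* y) ≡ u ℕ.* x ℕ.* 3 ℕ.* y
      lem = solveℕ-∀
    agree : ∀ q → N ≡ q ℕ.* 3 ^ suc a → ∀ i →
            target (3 ^ suc m) (u ℕ.* 3) i ≡ target (3 ^ suc a) q i [mod modulus (+ 3) (+ 1) i ]
    agree q N≡ ∞ = by (+ (3 ^ m) - + (3 ^ a)) (trans (cong (_- 1ℤ) (ℤᵖ.pos-* 3 (3 ^ m)))
      (trans (lem (+ (3 ^ m)) (+ (3 ^ a)))
        (cong (λ x → x - 1ℤ + (+ (3 ^ m) - + (3 ^ a)) * + 3) (sym (ℤᵖ.pos-* 3 (3 ^ a))))))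
      where
      lem : ∀ x y → + 3 * x - 1ℤ ≡ + 3 * y - 1ℤ + (x - y) * + 3
      lem = solve-∀
    agree q N≡ 𝟎 = by (+ u - + (u ℕ.* 3 ^ j)) (trans (cong (_- + N) (ℤᵖ.pos-* u 3))
      (trans (lem (+ u) (+ (u ℕ.* 3 ^ j)) (+ N)) (cong (λ x → x - + N + (+ u - + (u ℕ.* 3 ^ j)) * + 3)
        (sym (trans (cong +_ (q≡ q N≡)) (ℤᵖ.pos-* (u ℕ.* 3 ^ j) 3))))))
      where
      lem : ∀ x y N → x * + 3 - N ≡ y * + 3 - N + (x - y) * + 3
      lem = solve-∀
    agree q N≡ (at p pp) = by (+ v p (3 ^ suc m) - + v p (3 ^ suc a)) (lem (+ v p (3 ^ suc m)) (+ v p (3 ^ suc a)))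
      where
      lem : ∀ x y → x ≡ y + (x - y) * + 1
      lem = solve-∀

  reached-mod3 : ∀ {n} → n ℕᵈ.∣ N → Reached (+ 3) (+ 1) n
  reached-mod3 = reached-all prime[3] reached-3^ primes
    (λ 3∤p → 3∤z⇒3∣z²-1 (∤⇒+∤ 3∤p) , ℤᵈ.∣ᵤ⇒∣ (ℕᵈ.1∣ _))
    where
    primes : ∀ {p} → Prime p → p ≢ 3 → p ℕᵈ.∣ N → Reached (+ 3) (+ 1) p
    primes {p} pp p≢3 p∣N with p ℕᵖ.≟ 2
    ... | yes refl = reached-2-mod3 p∣N
    ... | no p≢2   = reached-𝓑 (large∈𝓑 pp p∣N p≢2 p≢3)

  -- The exponent a + 1 lies at least 3 below α = a + j + 4. Then 8 divides both N and the codivisor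
  -- `q`, so the wanted value at 0 is 0 modulo 8. What remains is to hit 2^(a+1) - 1 at ∞ with the
  -- parity of a + 1, and the parity of `j` tells whether that is the parity of α - 1 or of α.
  module SmallPowers (a j u : ℕ)
    (N≡u : N ≡ u ℕ.* 2 ^ (3 ℕ.+ (suc a ℕ.+ j)))
    (∈𝓑 : ∀ {n} → n ∈ 𝓑² (3 ℕ.+ (suc a ℕ.+ j)) → n ∈ 𝓑-list N)
    (q : ℕ) (N≡ : N ≡ q ℕ.* 2 ^ suc a) where

    m : ℕ
    m = suc a ℕ.+ j

    X Y U : ℤ
    X = + (2 ^ a)
    Y = + (2 ^ j)
    U = + u

    2^a : + (2 ^ suc a) ≡ + 2 * X
    2^a = ℤᵖ.pos-* 2 (2 ^ a)

    2^m : + (2 ^ m) ≡ + 2 * X * Y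
    2^m = trans (cong +_ (ℕᵖ.^-distribˡ-+-* 2 (suc a) j))
      (trans (ℤᵖ.pos-* (2 ^ suc a) (2 ^ j)) (cong (_* Y) 2^a))

    2^1+m : + (2 ^ (1 ℕ.+ m)) ≡ + 4 * X * Y
    2^1+m = trans (ℤᵖ.pos-* 2 (2 ^ m)) (trans (cong (+ 2 *_) 2^m) (lem X Y))
      where
      lem : ∀ x y → + 2 * (+ 2 * x * y) ≡ + 4 * x * y
      lem = solve-∀

    2^2+m : + (2 ^ (2 ℕ.+ m)) ≡ + 8 * X * Y
    2^2+m = trans (ℤᵖ.pos-* 2 (2 ^ (1 ℕ.+ m))) (trans (cong (+ 2 *_) 2^1+m) (lem X Y))
      where
      lem : ∀ x y → + 2 * (+ 4 * x * y) ≡ + 8 * x * y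
      lem = solve-∀

    2^3+m : + (2 ^ (3 ℕ.+ m)) ≡ + 16 * X * Y
    2^3+m = trans (ℤᵖ.pos-* 2 (2 ^ (2 ℕ.+ m))) (trans (cong (+ 2 *_) 2^2+m) (lem X Y))
      where
      lem : ∀ x y → + 2 * (+ 8 * x * y) ≡ + 16 * x * y
      lem = solve-∀

    +N : + N ≡ U * (+ 16 * X * Y)
    +N = trans (cong +_ N≡u) (trans (ℤᵖ.pos-* u (2 ^ (3 ℕ.+ m))) (cong (U *_) 2^3+m))

    +q : + q ≡ U * (+ 8 * Y)
    +q = ℤᵖ.*-cancelʳ-≡ (+ q) (U * (+ 8 * Y)) (+ (2 ^ suc a)) {{ℕᵖ.m^n≢0 2 (suc a)}} (begin
      + q * + (2 ^ suc a)          ≡⟨ ℤᵖ.pos-* q (2 ^ suc a) ⟨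
      + (q ℕ.* 2 ^ suc a)          ≡⟨ cong +_ N≡ ⟨
      + N                          ≡⟨ +N ⟩
      U * (+ 16 * X * Y)           ≡⟨ lem U X Y ⟩
      U * (+ 8 * Y) * (+ 2 * X)    ≡⟨ cong (U * (+ 8 * Y) *_) 2^a ⟨
      U * (+ 8 * Y) * + (2 ^ suc a) ∎)
      where
      open ≡-Reasoning
      lem : ∀ u x y → u * (+ 16 * x * y) ≡ u * (+ 8 * y) * (+ 2 * x)
      lem = solve-∀

    target-𝟎 : + q - + N ≡ U * (+ 8 * Y) - U * (+ 16 * X * Y)
    target-𝟎 = cong₂ _-_ +q +N

    v-2^ : ∀ {p} (pp : Prime p) k → + v p (2 ^ k) ≡ + k * + v p 2
    v-2^ {p} pp k = trans (cong +_ (v-^ pp _ k)) (ℤᵖ.pos-* k (v p 2))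

    r₁ = reached-𝓑 {+ 8} {+ 2} (∈𝓑 (here refl)) (u ℕ.* 4) (trans N≡u (lem u (2 ^ (1 ℕ.+ m))))
      where
      lem : ∀ u x → u ℕ.* (2 ℕ.* (2 ℕ.* x)) ≡ u ℕ.* 4 ℕ.* x
      lem = solveℕ-∀
    r₂ = reached-𝓑 {+ 8} {+ 2} (∈𝓑 (there (here refl))) (u ℕ.* 2) (trans N≡u (lem u (2 ^ (2 ℕ.+ m))))
      where
      lem : ∀ u x → u ℕ.* (2 ℕ.* x) ≡ u ℕ.* 2 ℕ.* x
      lem = solveℕ-∀
    r₃ = reached-𝓑 {+ 8} {+ 2} (∈𝓑 (there (there (here refl)))) u N≡u

    -- `x` is 2^(a+1) - 1, the value wanted at ∞. Both multipliers are odd, so scaling by them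
    -- preserves the parities; `s` is its own inverse modulo 8.
    x s : ℤ
    x = + 2 * X - 1ℤ
    s = + 4 * X * Y + + 3

    -- For α = m + 3, the element (e_{2^{α−1}} − e_1) − 2 (e_{2^α} − e_1) takes the values 1 at ∞
    -- and 0 at 0 modulo 8, and its valuation at 2 has the parity of α − 1.
    even-case : ∀ i → j ≡ i ℕ.+ i → Spanned (+ 8) (+ 2) (target (2 ^ suc a) q)
    even-case i j≡ = spanned-resp agree (spanned-* x (spanned-+ r₂ (spanned-* (- + 2) r₃)))
      where
      agree : ∀ i → x * (target (2 ^ (2 ℕ.+ m)) (u ℕ.* 2) i + - + 2 * target (2 ^ (3 ℕ.+ m)) u i)
                    ≡ target (2 ^ suc a) q i [mod modulus (+ 8) (+ 2) i ]
      agree ∞ = by (- (+ 3 * x * X * Y)) (trans (cong₂ (λ y z → x * (y - 1ℤ + - + 2 * (z - 1ℤ))) 2^2+m 2^3+m)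
        (trans (lem X Y) (cong (λ y → y - 1ℤ + - (+ 3 * x * X * Y) * + 8) (sym 2^a))))
        where
        lem : ∀ X Y → (+ 2 * X - 1ℤ) * (+ 8 * X * Y - 1ℤ + - + 2 * (+ 16 * X * Y - 1ℤ))
              ≡ + 2 * X - 1ℤ + - (+ 3 * (+ 2 * X - 1ℤ) * X * Y) * + 8
        lem = solve-∀
      agree 𝟎 = by (U * (x * + 2 * X * Y + + 2 * X * Y - Y)) (trans
        (cong₂ (λ y z → x * (y - z + - + 2 * (U - z))) (ℤᵖ.pos-* u 2) +N)
        (trans (lem U X Y) (cong (λ y → y + U * (x * + 2 * X * Y + + 2 * X * Y - Y) * + 8) (sym target-𝟎))))
        where
        lem : ∀ U X Y → (+ 2 * X - 1ℤ) * (U * + 2 - U * (+ 16 * X * Y) + - + 2 * (U - U * (+ 16 * X * Y)))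
              ≡ U * (+ 8 * Y) - U * (+ 16 * X * Y) + U * ((+ 2 * X - 1ℤ) * + 2 * X * Y + + 2 * X * Y - Y) * + 8
        lem = solve-∀
      agree (at p pp) = by T (trans
        (cong₂ (λ y z → x * (y + - + 2 * z)) (v-2^ pp (2 ℕ.+ m)) (v-2^ pp (3 ℕ.+ m)))
        -- The cast exponents `+ (2 ℕ.+ m)` and `+ (3 ℕ.+ m)` unfold by computation to
        -- `+ 3 + + a + + j` and `+ 4 + + a + + j`, which exposes `j` for rewriting.
        (trans (cong (λ j → x * ((+ 3 + + a + + j) * w + - + 2 * ((+ 4 + + a + + j) * w))) j≡)
        (trans (lem X (+ a) (+ i) w) (cong (λ y → y + T * + 2) (sym (v-2^ pp (suc a)))))))
        where
        w = + v p 2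
        T = (+ 2 + + i + X * (- + 5 - + a - (+ i + + i))) * w
        lem : ∀ X a i w → (+ 2 * X - 1ℤ) * ((+ 3 + a + (i + i)) * w + - + 2 * ((+ 4 + a + (i + i)) * w))
              ≡ (+ 1 + a) * w + (+ 2 + i + X * (- + 5 - a - (i + i))) * w * + 2
        lem = solve-∀

    -- Likewise (e_{2^{α−2}} − e_1) − 4 (e_{2^α} − e_1) takes the values s and 0 modulo 8, with valuation
    -- of the parity of α; since s is odd, s² ≡ 1.
    odd-case : ∀ i → j ≡ suc (i ℕ.+ i) → Spanned (+ 8) (+ 2) (target (2 ^ suc a) q)
    odd-case i j≡ = spanned-resp agree (spanned-* (x * s) (spanned-+ r₁ (spanned-* (- + 4) r₃)))
      where
      agree : ∀ i → x * s * (target (2 ^ (1 ℕ.+ m)) (u ℕ.* 4) i + - + 4 * target (2 ^ (3 ℕ.+ m)) u i)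
                    ≡ target (2 ^ suc a) q i [mod modulus (+ 8) (+ 2) i ]
      agree ∞ = by T (trans (cong₂ (λ y z → x * s * (y - 1ℤ + - + 4 * (z - 1ℤ))) 2^1+m 2^3+m)
        (trans (lem X Y) (cong (λ y → y - 1ℤ + T * + 8) (sym 2^a))))
        where
        T = x * (+ 2 * X * Y * X * Y + + 3 * X * Y + + 1 - s * + 8 * X * Y)
        lem : ∀ X Y → (+ 2 * X - 1ℤ) * (+ 4 * X * Y + + 3) * (+ 4 * X * Y - 1ℤ + - + 4 * (+ 16 * X * Y - 1ℤ))
              ≡ + 2 * X - 1ℤ
                + (+ 2 * X - 1ℤ) * (+ 2 * X * Y * X * Y + + 3 * X * Y + + 1 - (+ 4 * X * Y + + 3) * + 8 * X * Y) * + 8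
        lem = solve-∀
      agree 𝟎 = by T (trans (cong₂ (λ y z → x * s * (y - z + - + 4 * (U - z))) (ℤᵖ.pos-* u 4) +N)
        (trans (lem U X Y) (cong (λ y → y + T * + 8) (sym target-𝟎))))
        where
        T = U * (x * s * + 6 * X * Y + + 2 * X * Y - Y)
        lem : ∀ U X Y → (+ 2 * X - 1ℤ) * (+ 4 * X * Y + + 3)
                * (U * + 4 - U * (+ 16 * X * Y) + - + 4 * (U - U * (+ 16 * X * Y)))
              ≡ U * (+ 8 * Y) - U * (+ 16 * X * Y)
                + U * ((+ 2 * X - 1ℤ) * (+ 4 * X * Y + + 3) * + 6 * X * Y + + 2 * X * Y - Y) * + 8
        lem = solve-∀
      agree (at p pp) = by T (trans
        (cong₂ (λ y z → x * s * (y + - + 4 * z)) (v-2^ pp (1 ℕ.+ m)) (v-2^ pp (3 ℕ.+ m)))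
        (trans (cong (λ j → x * s * ((+ 2 + + a + + j) * w + - + 4 * ((+ 4 + + a + + j) * w))) j≡)
        (trans (lem X Y (+ a) (+ i) w) (cong (λ y → y + T * + 2) (sym (v-2^ pp (suc a)))))))
        where
        w = + v p 2
        T = ((+ 4 * X * X * Y + + 3 * X - + 2 * X * Y) * (- + 17 - + 3 * + a - + 6 * + i)
             + (+ 25 + + 4 * + a + + 9 * + i)) * w
        lem : ∀ X Y a i w → (+ 2 * X - 1ℤ) * (+ 4 * X * Y + + 3)
                * ((+ 2 + a + (+ 1 + (i + i))) * w + - + 4 * ((+ 4 + a + (+ 1 + (i + i))) * w))
              ≡ (+ 1 + a) * w
                + ((+ 4 * X * X * Y + + 3 * X - + 2 * X * Y) * (- + 17 - + 3 * a - + 6 * i) + (+ 25 + + 4 * a + + 9 * i)) * w * + 2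
        lem = solve-∀

  reached-2^ : ∀ a → 2 ^ a ℕᵈ.∣ N → Reached (+ 8) (+ 2) (2 ^ a)
  reached-2^ zero d = reached-1
  reached-2^ (suc a) d with v 2 N in α≡ | v-max prime[2] {k = suc a} N≢0 d | ^-v-∣ 2 N
  ... | 1 | s≤s z≤n       | _ = reached-𝓑 (𝓑²⊆𝓑 (∣-trans (ℕᵈ.m∣m*n (2 ^ a)) d) α≡ (here refl))
  ... | 2 | s≤s z≤n       | _ = reached-𝓑 (𝓑²⊆𝓑 (∣-trans (ℕᵈ.m∣m*n (2 ^ a)) d) α≡ (here refl))
  ... | 2 | s≤s (s≤s z≤n) | _ = reached-𝓑 (𝓑²⊆𝓑 (∣-trans (ℕᵈ.m∣m*n (2 ^ a)) d) α≡ (there (here refl)))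
  -- Here α = m + 3. The comparisons peel off the exponents α, α - 1 and α - 2, which belong to 𝓑_N;
  -- anything smaller is decided by the parity of its distance to α - 3.
  ... | suc (suc (suc m)) | s≤s a≤2+m | ℕᵈ.divides u N≡u with ℕᵖ.m≤n⇒m<n∨m≡n a≤2+m
  ...   | inj₂ refl = reached-𝓑 (𝓑²⊆𝓑 (∣-trans (ℕᵈ.m∣m*n (2 ^ a)) d) α≡ (there (there (here refl))))
  ...   | inj₁ (s≤s a≤1+m) with ℕᵖ.m≤n⇒m<n∨m≡n a≤1+m
  ...     | inj₂ refl = reached-𝓑 (𝓑²⊆𝓑 (∣-trans (ℕᵈ.m∣m*n (2 ^ a)) d) α≡ (there (here refl)))
  ...     | inj₁ (s≤s a≤m) with ℕᵖ.m≤n⇒m<n∨m≡n a≤m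
  ...       | inj₂ refl = reached-𝓑 (𝓑²⊆𝓑 (∣-trans (ℕᵈ.m∣m*n (2 ^ a)) d) α≡ (here refl))
  ...       | inj₁ a<m with j , refl ← ℕᵖ.m≤n⇒∃[o]m+o≡n a<m with parity j
  ...         | i , inj₁ j≡ = λ q N≡ →
    SmallPowers.even-case a j u N≡u (𝓑²⊆𝓑 (∣-trans (ℕᵈ.m∣m*n (2 ^ a)) d) α≡) q N≡ i j≡
  ...         | i , inj₂ j≡ = λ q N≡ →
    SmallPowers.odd-case a j u N≡u (𝓑²⊆𝓑 (∣-trans (ℕᵈ.m∣m*n (2 ^ a)) d) α≡) q N≡ i j≡

  reached-mod8 : ∀ {n} → n ℕᵈ.∣ N → Reached (+ 8) (+ 2) n
  reached-mod8 = reached-all prime[2] reached-2^ primes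
    (λ 2∤p → odd⇒8∣z²-1 (∤⇒+∤ 2∤p) , odd⇒2∣z-1 (∤⇒+∤ 2∤p))
    where
    primes : ∀ {p} → Prime p → p ≢ 2 → p ℕᵈ.∣ N → Reached (+ 8) (+ 2) p
    primes {p} pp p≢2 p∣N with p ℕᵖ.≟ 3
    ... | yes refl = reached-3-mod8 p∣N
    ... | no p≢3   = reached-𝓑 (large∈𝓑 pp p∣N p≢2 p≢3)

  -- Chinese remainders: 16 and 9 are the idempotents of ℤ/3 × ℤ/8.
  spanned-crt : ∀ {X} → Spanned (+ 3) (+ 1) X → Spanned (+ 8) (+ 2) X → Spanned (+ 24) (+ 2) X
  spanned-crt {X} (c , p) (d , r) = (λ b → + 16 * c b + + 9 * d b) , agree
    where
    split : ∀ i → L (weight i) (λ b → + 16 * c b + + 9 * d b) ≡ + 16 * L (weight i) c + + 9 * L (weight i) d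
    split i = trans (L-+ (weight i) (λ b → + 16 * c b) (λ b → + 9 * d b))
      (cong₂ _+_ (L-* (weight i) (+ 16) c) (L-* (weight i) (+ 9) d))
    crt : ∀ {a b x} → a ≡ x [mod + 3 ] → b ≡ x [mod + 8 ] → + 16 * a + + 9 * b ≡ x [mod + 24 ]
    crt {x = x} (by s refl) (by t refl) = by (x + + 2 * s + + 3 * t) (lem x s t)
      where
      lem : ∀ x s t → + 16 * (x + s * + 3) + + 9 * (x + t * + 8) ≡ x + (x + + 2 * s + + 3 * t) * + 24
      lem = solve-∀
    -- 16 is even and 9 is odd, so the parities are inherited from the part modulo 8 alone.
    parity-part : ∀ a {b x} → b ≡ x [mod + 2 ] → + 16 * a + + 9 * b ≡ x [mod + 2 ]
    parity-part a {x = x} (by t refl) = by (+ 8 * a + + 4 * x + + 9 * t) (lem a x t)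
      where
      lem : ∀ a x t → + 16 * a + + 9 * (x + t * + 2) ≡ x + (+ 8 * a + + 4 * x + + 9 * t) * + 2
      lem = solve-∀
    agree : ∀ i → L (weight i) (λ b → + 16 * c b + + 9 * d b) ≡ X i [mod M i ]
    agree ∞          = mod-trans (mod-reflexive (split ∞)) (crt (p ∞) (r ∞))
    agree 𝟎          = mod-trans (mod-reflexive (split 𝟎)) (crt (p 𝟎) (r 𝟎))
    agree i@(at _ _) = mod-trans (mod-reflexive (split i)) (parity-part (L (weight i) c) (r i))

  basis : ∀ (n : 𝓓 N) → ∃ λ c → ∀ i → L (weight i) c ≡ weight i n - weight i one [mod M i ]
  basis n = spanned-resp (λ i → mod-reflexive (sym (target≡ n q N≡ i)))
    (spanned-crt (reached-mod3 n∣N q N≡) (reached-mod8 n∣N q N≡))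
    where
    n∣N = proj₂ (𝓓-witness n)
    q = ℕᵈ.quotient n∣N
    N≡ = ℕᵈ._∣_.equality n∣N

  -- Because Σ r_n = 0, the vector r equals Σ r_n (e_n - e_1), and `basis` handles each summand.
  surjective : ∀ r → S N r → ∃ λ c → ∀ i → L (weight i) c ≡ ⟨ weight i , r ⟩ [mod M i ]
  surjective r r∈S = c , λ i → mod-trans (mod-reflexive (L-c (weight i)))
    (mod-trans (∑-mod (divisors N) (λ n → mod-*ˡ (r n) (proj₂ (basis n) i))) (mod-reflexive (degree-zero (weight i))))
    where
    open ≡-Reasoning
    c : 𝓑 N → ℤ
    c b = ∑ (divisors N) (λ n → r n * proj₁ (basis n) b)
    L-c : ∀ w → L w c ≡ ∑ (divisors N) (λ n → r n * L w (proj₁ (basis n)))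
    L-c w = trans (L-∑ w (divisors N) (λ n b → r n * proj₁ (basis n) b))
                  (∑-cong (divisors N) (λ n → L-* w (r n) (proj₁ (basis n))))
    degree-zero : ∀ w → ∑ (divisors N) (λ n → r n * (w n - w one)) ≡ ⟨ w , r ⟩
    degree-zero w = begin
      ∑ (divisors N) (λ n → r n * (w n - w one))               ≡⟨ ∑-cong (divisors N) (λ n → lem (r n) (w n) (w one)) ⟩
      ∑ (divisors N) (λ n → w n * r n + - w one * r n)         ≡⟨ ∑-+ (divisors N) (λ n → w n * r n) (λ n → - w one * r n) ⟩
      ⟨ w , r ⟩ + ∑ (divisors N) (λ n → - w one * r n)         ≡⟨ cong (_+_ ⟨ w , r ⟩) (∑-*ˡ (divisors N) (- w one) r) ⟩
      ⟨ w , r ⟩ + - w one * ∑ (divisors N) r                   ≡⟨ cong (λ x → ⟨ w , r ⟩ + - w one * x) r∈S ⟩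
      ⟨ w , r ⟩ + - w one * 0ℤ                                 ≡⟨ cong (_+_ ⟨ w , r ⟩) (ℤᵖ.*-zeroʳ (- w one)) ⟩
      ⟨ w , r ⟩ + 0ℤ                                           ≡⟨ ℤᵖ.+-identityʳ ⟨ w , r ⟩ ⟩
      ⟨ w , r ⟩                                                ∎
      where
      lem : ∀ r w w₁ → r * (w - w₁) ≡ w * r + - w₁ * r
      lem = solve-∀

-- Reduction modulo the relations

module Reduction (N : ℕ) (N≢0 : NonZero N) {t : ℕ} (b : Ordering N t)
  (Δ : Fin t → ℕ) (isΔ : ∀ i → IsΔ N b i (Δ i)) where
  open Functionals N N≢0
  open Bijection b using (to; strictlySurjective)

  InBox : (𝓑 N → ℤ) → Fin t → Set
  InBox c j = 0ℤ ℤ.≤ c (to j) × c (to j) ℤ.< + Δ j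

  _∼_ : (c d : 𝓑 N → ℤ) → Set
  c ∼ d = ∀ i → L (weight i) c ≡ L (weight i) d [mod M i ]

  relation-scale : ∀ k {c} → Relation c → Relation (λ n → k * c n)
  relation-scale k {c} R i = mod-trans (mod-reflexive (L-* (weight i) k c))
    (mod-trans (mod-*ˡ k (R i)) (mod-reflexive (ℤᵖ.*-zeroʳ k)))

  ∼⇒relation : ∀ {c d} → c ∼ d → Relation (λ n → c n - d n)
  ∼⇒relation {c} {d} c∼d i = mod-trans (mod-reflexive (L-- (weight i) c d))
    (mod-trans (mod-- (c∼d i) (mod-reflexive refl)) (mod-reflexive (ℤᵖ.+-inverseʳ (L (weight i) d))))

  instance
    Δ-nonZero : ∀ {i} → NonZero (Δ i)
    Δ-nonZero {i} = ℕ.>-nonZero (IsΔ.1≤m (isΔ i))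

  -- Subtract a multiple of the solution attaining Δ_i. It vanishes before position i, so earlier
  -- entries survive; later ones may change, which is why `reduce-below` works through the positions
  -- in increasing order.
  reduce-at : ∀ i c → ∃ λ d → (d ∼ c) × (∀ j → j Fin.< i → d (to j) ≡ c (to j)) × InBox d i
  reduce-at i c = d , d∼c , unchanged , subst (0ℤ ℤ.≤_) (sym d-i) (ℤ.+≤+ z≤n) ,
      subst (ℤ._< + Δ i) (sym d-i) (ℤ.+<+ (n%ℕd<d (c (to i)) (Δ i)))
    where
    g = proj₁ (IsΔ.attained (isΔ i))
    g-relation : Relation g
    g-relation = system⇒relation (proj₁ (proj₂ (IsΔ.attained (isΔ i))))
    g-zero = proj₁ (proj₂ (proj₂ (IsΔ.attained (isΔ i))))
    g-i : g (to i) ≡ + Δ i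
    g-i = proj₂ (proj₂ (proj₂ (IsΔ.attained (isΔ i))))
    x = c (to i) ℤ./ℕ Δ i
    d : 𝓑 N → ℤ
    d n = c n - x * g n
    d∼c : d ∼ c
    d∼c k = mod-trans (mod-reflexive (L-- (weight k) c (λ n → x * g n)))
      (mod-trans (mod-- (mod-reflexive {a = L (weight k) c} refl) (relation-scale x g-relation k))
        (mod-reflexive (ℤᵖ.+-identityʳ (L (weight k) c))))
    unchanged : ∀ j → j Fin.< i → d (to j) ≡ c (to j)
    unchanged j j<i = trans (cong (λ z → c (to j) - x * z) (g-zero j j<i)) (lem (c (to j)) x)
      where
      lem : ∀ c x → c - x * 0ℤ ≡ c
      lem = solve-∀
    d-i : d (to i) ≡ + (c (to i) ℤ.%ℕ Δ i)
    d-i = trans (cong₂ (λ y z → y - x * z) (a≡a%ℕn+[a/ℕn]*n (c (to i)) (Δ i)) g-i)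
      (lem (+ (c (to i) ℤ.%ℕ Δ i)) (x * + Δ i))
      where
      lem : ∀ r y → r + y - y ≡ r
      lem = solve-∀

  reduce-below : ∀ k → k ℕ.≤ t → ∀ c → ∃ λ d → (d ∼ c) × (∀ j → toℕ j ℕ.< k → InBox d j)
  reduce-below zero    _   c = c , (λ _ → mod-reflexive refl) , λ _ ()
  reduce-below (suc k) k<t c = d′ , (λ i → mod-trans (d′∼d i) (d∼c i)) , box′
    where
    i = Fin.fromℕ< k<t
    step₁ = reduce-below k (ℕᵖ.<⇒≤ k<t) c
    d = proj₁ step₁
    d∼c = proj₁ (proj₂ step₁)
    step₂ = reduce-at i d
    d′ = proj₁ step₂
    d′∼d = proj₁ (proj₂ step₂)
    box′ : ∀ j → toℕ j ℕ.< suc k → InBox d′ j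
    box′ j (s≤s j≤k) with ℕᵖ.m≤n⇒m<n∨m≡n j≤k
    ... | inj₁ j<k = subst (λ z → 0ℤ ℤ.≤ z × z ℤ.< + Δ j)
          (sym (proj₁ (proj₂ (proj₂ step₂)) j (subst (toℕ j ℕ.<_) (sym (Finᵖ.toℕ-fromℕ< k<t)) j<k)))
          (proj₂ (proj₂ step₁) j j<k)
    ... | inj₂ j≡k = subst (InBox d′) (Finᵖ.toℕ-injective (trans (Finᵖ.toℕ-fromℕ< k<t) (sym j≡k)))
          (proj₂ (proj₂ (proj₂ step₂)))

  reduce : ∀ c → ∃ λ d → (d ∼ c) × (∀ j → InBox d j)
  reduce c with d , d∼c , box ← reduce-below t ℕᵖ.≤-refl c = d , d∼c , λ j → box j (Finᵖ.toℕ<n j)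

  -- Minimality of Δ_i concerns only candidates up to 24; the bound Δ_i ≤ 24 places every smaller
  -- positive entry in that range.
  no-small-entry : ∀ i {c} → Relation c → (∀ j → j Fin.< i → c (to j) ≡ 0ℤ) →
                   ∀ m → c (to i) ≡ + suc m → ¬ suc m ℕ.< Δ i
  no-small-entry i R zeros m eq m<Δ = ℕᵖ.<⇒≱ m<Δ (IsΔ.least (isΔ i) (s≤s z≤n)
    (ℕᵖ.≤-trans (ℕᵖ.<⇒≤ m<Δ) (IsΔ.m≤24 (isΔ i))) (_ , relation⇒system R , zeros , eq))

  ≮-in-box : ∀ i {c d} → c ∼ d → (∀ j → j Fin.< i → c (to j) ≡ d (to j)) →
             InBox c i → InBox d i → ¬ d (to i) ℤ.< c (to i)
  ≮-in-box i {c} {d} c∼d agree (_ , c<Δ) (0≤d , _) d<c with gap 0≤d d<c c<Δ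
  ... | m , eq , m<Δ = no-small-entry i (∼⇒relation {c} {d} c∼d)
    (λ j j<i → trans (cong (_- d (to j)) (agree j j<i)) (ℤᵖ.+-inverseʳ (d (to j)))) m eq m<Δ

  -- At a first position of disagreement the difference, signed to be positive there, is a solution
  -- of (S) vanishing earlier with an entry strictly between 0 and Δ_i, against minimality.
  box-unique : ∀ {c d} → c ∼ d → (∀ j → InBox c j) → (∀ j → InBox d j) → ∀ n → c n ≡ d n
  box-unique {c} {d} c∼d c-box d-box n with i , refl ← strictlySurjective n = <-rec Agree step (toℕ i) i refl
    where
    Agree : ℕ → Set
    Agree k = ∀ i → toℕ i ≡ k → c (to i) ≡ d (to i)
    step : ∀ k → (∀ {k′} → k′ ℕ.< k → Agree k′) → Agree k
    step k rec i refl with ℤᵖ.<-cmp (c (to i)) (d (to i))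
    ... | tri≈ _ eq _ = eq
    ... | tri> _ _ d<c = contradiction d<c (≮-in-box i c∼d (λ j j<i → rec j<i j refl) (c-box i) (d-box i))
    ... | tri< c<d _ _ = contradiction c<d
      (≮-in-box i (λ k → mod-sym (c∼d k)) (λ j j<i → sym (rec j<i j refl)) (d-box i) (c-box i))

theorem6p8 : (N : ℕ) → 2 ≤ N → (t : ℕ) (b : Ordering N t) (Δ : Fin t → ℕ) →
    (∀ i → IsΔ N b i (Δ i)) →
    CompleteRepresentatives (S N) (Z N) (Representative N b Δ)
theorem6p8 N 2≤N t b Δ isΔ = representative⊆S , λ r r∈S →
    let c , Lc≡r = surjective r r∈S
        d , d∼c , d-box = reduce c
    in vector N b d
     , ((d , d-box , λ _ → refl)
       , trivial⇒Z (⊖-S r (vector N b d) r∈S (vector-S b d)) (λ i →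
           coset⇒trivial i r d (mod-trans (d∼c i) (Lc≡r i))))
     -- Any other representative in the coset has the same functional values as `r`, hence as `d`,
     -- and both coefficient vectors lie in the box.
     , λ { {y} ((d′ , d′-box , y≗) , z) n → trans
         (vector-cong (box-unique {d} {d′}
           (λ i → mod-trans (mod-trans (d∼c i) (Lc≡r i)) (mod-sym (trivial⇒coset i r y d′ y≗ z))) d-box d′-box) n)
         (sym (y≗ n)) }
  where
  N≢0 : NonZero N
  N≢0 = ℕ.>-nonZero (ℕᵖ.≤-trans (s≤s z≤n) 2≤N)
  open Functionals N N≢0
  open Generation N N≢0
  open Reduction N N≢0 b Δ isΔ
  open Bijection b using (to)

  S-resp : ∀ {r s : Lattice N} → r ≗ s → S N s → S N r
  S-resp r≗s s∈S = trans (∑-cong (divisors N) r≗s) s∈S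

  representative⊆S : ∀ {r} → Representative N b Δ r → S N r
  representative⊆S (c , _ , r≗) = S-resp r≗ (vector-S b c)

  ⊖-S : ∀ r s → S N r → S N s → S N (r ⊖ s)
  ⊖-S r s r∈S s∈S = trans (∑≡⟨1,⟩ (r ⊖ s)) (trans (⟨⟩-⊖ (λ _ → 1ℤ) r s)
    (cong₂ _-_ (trans (sym (∑≡⟨1,⟩ r)) r∈S) (trans (sym (∑≡⟨1,⟩ s)) s∈S)))

  coset⇒trivial : ∀ i r d → L (weight i) d ≡ ⟨ weight i , r ⟩ [mod M i ] →
                  ⟨ weight i , r ⊖ vector N b d ⟩ ≡ 0ℤ [mod M i ]
  coset⇒trivial i r d Ld≡r = mod-trans (mod-reflexive (⟨⟩-⊖ (weight i) r (vector N b d)))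
    (mod-trans (mod-- (mod-sym Ld≡r) (mod-reflexive (⟨⟩-vector b (weight i) d)))
      (mod-reflexive (ℤᵖ.+-inverseʳ (L (weight i) d))))

  trivial⇒coset : ∀ i r y d → y ≗ vector N b d → Z N (r ⊖ y) → L (weight i) d ≡ ⟨ weight i , r ⟩ [mod M i ]
  trivial⇒coset i r y d y≗ z = mod-sym (mod-trans (mod-reflexive (begin
      ⟨ weight i , r ⟩                                        ≡⟨ lem ⟨ weight i , r ⟩ ⟨ weight i , y ⟩ ⟩
      ⟨ weight i , r ⟩ - ⟨ weight i , y ⟩ + ⟨ weight i , y ⟩  ≡⟨ cong₂ _+_ (⟨⟩-⊖ (weight i) r y) Ld≡ ⟨
      ⟨ weight i , r ⊖ y ⟩ + L (weight i) d                   ∎))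
    (mod-trans (mod-+ (Z⇒trivial z i) (mod-reflexive {a = L (weight i) d} refl))
      (mod-reflexive (ℤᵖ.+-identityˡ (L (weight i) d)))))
    where
    open ≡-Reasoning
    lem : ∀ x y → x ≡ x - y + y
    lem = solve-∀
    Ld≡ : L (weight i) d ≡ ⟨ weight i , y ⟩
    Ld≡ = trans (sym (⟨⟩-vector b (weight i) d)) (∑-cong (divisors N) (λ n → cong (weight i n *_) (sym (y≗ n))))

  vector-cong : ∀ {c d} → (∀ n → c n ≡ d n) → vector N b c ≗ vector N b d
  vector-cong c≗d n = cong₂ (λ x y → x - y * e one n)
    (∑-cong (allFin t) (λ j → cong (_* e (𝓑⇒𝓓 N (to j)) n) (c≗d (to j))))
    (∑-cong (allFin t) (λ j → c≗d (to j)))
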